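{- Let $\mathcal{P}$ be a locally geometric poset with $A(\mathcal{P})\ne\emptyset$ and let $a\in A(\mathcal{P})$. (a) Suppose $a$ is not a separator of $\mathcal{P}$. If $\mathcal{P}''$ is inductive with $\exp(\mathcal{P}'')=\{d_1,\dots,d_{\ell-1}\}$ and $\mathcal{P}'$ is inductive with $\exp(\mathcal{P}')=\{d_1,\dots,d_{\ell-1},d_\ell\}$, then $\mathcal{P}$ is inductive with $\exp(\mathcal{P})=\{d_1,\dots,d_{\ell-1},d_\ell+1\}$. (b) Suppose $a$ is a separator of $\mathcal{P}$. If $\mathcal{P}''$ and $\mathcal{P}'$ are inductive with $\exp(\mathcal{P}'')=\exp(\mathcal{P}')=\{d_1,\dots,d_{\ell-1}\}$, then $\mathcal{P}$ is inductive with $\exp(\mathcal{P})=\{1,d_1,\dots,d_{\ell-1}\}$.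
   Context: All posets are finite, have a unique minimal element $\hat0$ and are ranked; $\operatorname{rk}(\mathcal{P})=\max\operatorname{rk}$; $\chi_{\mathcal{P}}(t)=\sum_x\mu(\hat0,x)t^{\operatorname{rk}(\mathcal{P})-\operatorname{rk}(x)}$. A poset is factorable if all roots of $\chi$ are positive integers, and $\exp$ denotes the multiset of roots (inductive posets are factorable). $A(\mathcal{P})$ is the set of atoms; $\bigvee T$ the set of minimal upper bounds of $T$. A lattice is geometric if $y$ covers $x$ iff there is an atom $a\not\le x$ with $y=x\vee a$; $\mathcal{P}$ is locally geometric if each $\mathcal{P}_{\le x}$ is a geometric lattice. For an atom $a$: $\mathcal{P}'$ is the subposet consisting of $\hat0$ and all elements of $\bigvee T$ for nonempty $T\subseteq A(\mathcal{P})\setminus\{a\}$; $\mathcal{P}''=\mathcal{P}_{\ge a}$ (minimal element $a$, rank $\operatorname{rk}-1$). The atom $a$ is a separator if $\operatorname{rk}(\mathcal{P})-\operatorname{rk}(\mathcal{P}')=1$ (this difference is always $0$ or $1$). Inductive posets: smallest class of locally geometric posets containing $\{\hat0\}$ and containing $\mathcal{P}$ whenever some atom $a$ has $\mathcal{P}',\mathcal{P}''$ inductive and $\chi_{\mathcal{P}''}\mid\chi_{\mathcal{P}'}$. -}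

module Defs where

open import Level using (0ℓ)
open import Data.Nat.Base as ℕ using (ℕ; zero; suc; _∸_; _⊔_)
open import Data.Integer.Base as ℤ using (ℤ; +_; 0ℤ; 1ℤ)
open import Data.Fin.Base using (Fin)
open import Data.Fin.Induction using (spo-wellFounded)
open import Data.List.Base using (List; []; _∷_; _++_; [_]; map; foldr; replicate; length; lookup; filter)
open import Data.List.Relation.Unary.All as All using (All; []; _∷_; all?)
open import Data.List.Relation.Unary.All.Properties using (all-filter)
open import Data.List.Relation.Unary.Any as Any using (Any; here; there; index; any?)
open import Data.List.Relation.Unary.Any.Properties using (lookup-index)
open import Data.List.Relation.Unary.AllPairs using ([]; _∷_)
open import Data.List.Relation.Unary.Enumerates.Setoid using (IsEnumeration)
open import Data.List.Relation.Unary.Unique.Setoid using (Unique)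
import Data.List.Membership.Setoid as Membership
import Data.List.Membership.Setoid.Properties as Membershipₚ
open import Data.Product.Base using (Σ; ∃; _×_; _,_; proj₁; proj₂)
open import Data.Sum.Base using (_⊎_; inj₁; inj₂)
open import Data.Empty using (⊥-elim)
open import Function.Base using (_∘_)
open import Function.Bundles using (_⇔_)
open import Induction.WellFounded using (WellFounded; Acc; acc; module All)
open import Relation.Binary.Bundles using (DecPoset)
open import Relation.Binary.Definitions using (Minimum; _Respects_)
import Relation.Binary.Construct.On as On
import Relation.Binary.Construct.NonStrictToStrict as ToStrict
open import Relation.Binary.Lattice.Structures using (IsLattice)
import Relation.Binary.Properties.Poset as Posetₚ
open import Relation.Binary.PropositionalEquality using (_≡_; _≢_)
open import Relation.Nullary using (¬_; Dec; yes; no; ¬?; _×-dec_; _⊎-dec_)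
open import Relation.Nullary.Decidable using (map′)
open import Relation.Unary using (Pred; Decidable)

------------------------------------------------------------------------
-- ℤ[t]: coefficient lists, constant term first. Trailing zeros are
-- allowed, so equality of polynomials is _≈ₚ_.

Poly : Set
Poly = List ℤ

coeff : Poly → ℕ → ℤ
coeff []      _       = 0ℤ
coeff (c ∷ p) zero    = c
coeff (c ∷ p) (suc k) = coeff p k

infix  4 _≈ₚ_ _∣ₚ_
infixl 6 _+ₚ_
infixl 7 _*ₚ_ _·ₚ_

_≈ₚ_ : Poly → Poly → Set
p ≈ₚ q = ∀ k → coeff p k ≡ coeff q k

_+ₚ_ : Poly → Poly → Poly
[]      +ₚ q       = q
(c ∷ p) +ₚ []      = c ∷ p
(c ∷ p) +ₚ (d ∷ q) = (c ℤ.+ d) ∷ (p +ₚ q)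

_·ₚ_ : ℤ → Poly → Poly
c ·ₚ p = map (c ℤ.*_) p

_*ₚ_ : Poly → Poly → Poly
[]      *ₚ q = []
(c ∷ p) *ₚ q = (c ·ₚ q) +ₚ (0ℤ ∷ (p *ₚ q))

_∣ₚ_ : Poly → Poly → Set
p ∣ₚ q = ∃ λ r → q ≈ₚ r *ₚ p

monomial : ℤ → ℕ → Poly
monomial c k = replicate k 0ℤ ++ [ c ]

sumₚ : List Poly → Poly
sumₚ = foldr _+ₚ_ []

t-_ : ℤ → Poly
t- r = (ℤ.- r) ∷ 1ℤ ∷ []

-- All complex roots of p, counted with multiplicity, are the integers
-- listed in rs (as a multiset): p is a nonzero constant times ∏ (t - r).
HasRoots : Poly → List ℤ → Set
HasRoots p rs = ∃ λ c → c ≢ 0ℤ × p ≈ₚ c ·ₚ foldr (λ r q → (t- r) *ₚ q) [ 1ℤ ] rs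

------------------------------------------------------------------------
-- Finite posets with a least element. Equality is a setoid equality so
-- that subposets can be carried by Σ-types.

record FinitePoset : Set₁ where
  field
    decPoset : DecPoset 0ℓ 0ℓ 0ℓ

  open DecPoset decPoset public
  open Posetₚ poset public using (_<_; <-isStrictPartialOrder; <-respˡ-≈; <-respʳ-≈)

  field
    elements    : List Carrier
    enumeration : IsEnumeration Eq.setoid elements
    unique      : Unique Eq.setoid elements
    0̂           : Carrier
    0̂-minimum   : Minimum _≤_ 0̂

  infix 4 _<?_ _⋖_ _∈⋁_

  _<?_ : ∀ x y → Dec (x < y)
  _<?_ = ToStrict.<-decidable _≈_ _≤_ _≟_ _≤?_

  -- Opaque only to keep normal forms small.
  opaque
    <-wellFounded : WellFounded _<_
    <-wellFounded x = go (lookup-index (enumeration x)) (lt-wf (index (enumeration x)))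
      where
      lt : Fin (length elements) → Fin (length elements) → Set
      lt i j = lookup elements i < lookup elements j

      lt-wf : WellFounded lt
      lt-wf = spo-wellFounded (On.isStrictPartialOrder (lookup elements) <-isStrictPartialOrder)

      go : ∀ {x i} → x ≈ lookup elements i → Acc lt i → Acc _<_ x
      go x≈i (acc rs) = acc λ {y} y<x →
        go (lookup-index (enumeration y))
           (rs (<-respˡ-≈ (lookup-index (enumeration y)) (<-respʳ-≈ x≈i y<x)))

  -- y covers x
  _⋖_ : Carrier → Carrier → Set
  x ⋖ y = x < y × ¬ ∃ λ z → x < z × z < y

  Atom : Carrier → Set
  Atom a = 0̂ ⋖ a

  UpperBound : List Carrier → Carrier → Set
  UpperBound T x = All (_≤ x) T

  -- x is one of the minimal upper bounds of T
  _∈⋁_ : Carrier → List Carrier → Set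
  x ∈⋁ T = UpperBound T x × (∀ y → UpperBound T y → ¬ y < x)

  -- A chain of n + 1 elements ending at x and maximal among the chains
  -- with greatest element x: it starts at 0̂ and every step is a cover.
  data MaximalChain : Carrier → ℕ → Set where
    start  : ∀ {x} → x ≈ 0̂ → MaximalChain x 0
    extend : ∀ {x y n} → MaximalChain x n → x ⋖ y → MaximalChain y (suc n)

  Ranked : Set
  Ranked = ∀ x {m n} → MaximalChain x m → MaximalChain x n → m ≡ n

  if-yes : {A B : Set} → Dec A → (A → B) → B → B
  if-yes (yes p) f _ = f p
  if-yes (no _)  _ b = b

  -- The length of a longest chain with greatest element x; if the poset
  -- is ranked, all maximal such chains have this length.
  rk : Carrier → ℕ
  rk = All.wfRec <-wellFounded 0ℓ (λ _ → ℕ) λ x rec →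
    foldr _⊔_ 0 (map (λ y → if-yes (y <? x) (λ y<x → suc (rec y<x)) 0) elements)

  rank : ℕ
  rank = foldr _⊔_ 0 (map rk elements)

  -- μ x x = 1 and μ x y = - Σ_{x ≤ z < y} μ x z for y ≉ x; in
  -- particular μ x y = 0 when x ≰ y.
  μ : Carrier → Carrier → ℤ
  μ x = All.wfRec <-wellFounded 0ℓ (λ _ → ℤ) λ y rec →
    if-yes (x ≟ y) (λ _ → 1ℤ)
      (ℤ.- foldr ℤ._+_ 0ℤ
        (map (λ z → if-yes (x ≤? z ×-dec z <? y) (λ (_ , z<y) → rec z<y) 0ℤ) elements))

  χ : Poly
  χ = sumₚ (map (λ x → monomial (μ 0̂ x) (rank ∸ rk x)) elements)

open FinitePoset using (Carrier; 0̂; Atom; Ranked; rank; χ)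

-- exp(P) is the multiset ds; in particular P is factorable.
Exp : FinitePoset → List ℕ → Set
Exp P ds = All (0 ℕ.<_) ds × HasRoots (χ P) (map +_ ds)

record GeometricLattice (L : FinitePoset) : Set where
  open FinitePoset L hiding (Carrier; Atom)
  field
    _∨_ _∧_   : Carrier L → Carrier L → Carrier L
    isLattice : IsLattice _≈_ _≤_ _∨_ _∧_
    covers    : ∀ x y → x ⋖ y ⇔ ∃ λ a → Atom L a × ¬ a ≤ x × y ≈ (x ∨ a)

------------------------------------------------------------------------
-- The subposet on {x | Q x}, when it has a least element m.

module Subposet (P : FinitePoset) where
  open FinitePoset P hiding (Carrier; 0̂)

  module _ {Q : Pred (Carrier P) 0ℓ} (Q? : Decidable Q) (Q-resp : Q Respects _≈_)
           (m : Carrier P) (Qm : Q m) (m-min : ∀ x → Q x → m ≤ x) where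

    subDecPoset : DecPoset 0ℓ 0ℓ 0ℓ
    subDecPoset = On.decPoset decPoset (proj₁ {B = Q})

    module Sub = DecPoset subDecPoset

    restrict : List (Carrier P) → List (Σ (Carrier P) Q)
    restrict [] = []
    restrict (x ∷ xs) with Q? x
    ... | yes q = (x , q) ∷ restrict xs
    ... | no _  = restrict xs

    restrict-complete : ∀ xs (y : Σ (Carrier P) Q) →
                        Any (proj₁ y ≈_) xs → Any (y Sub.≈_) (restrict xs)
    restrict-complete (x ∷ xs) y e with Q? x
    restrict-complete (x ∷ xs) y (here y≈x) | yes _ = here y≈x
    restrict-complete (x ∷ xs) y (there e)  | yes _ = there (restrict-complete xs y e)
    restrict-complete (x ∷ xs) y (here y≈x) | no ¬q = ⊥-elim (¬q (Q-resp y≈x (proj₂ y)))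
    restrict-complete (x ∷ xs) y (there e)  | no _  = restrict-complete xs y e

    restrict-all : ∀ {R : Pred (Carrier P) 0ℓ} {xs} → All R xs → All (R ∘ proj₁) (restrict xs)
    restrict-all [] = []
    restrict-all {xs = x ∷ _} (r ∷ rs) with Q? x
    ... | yes _ = r ∷ restrict-all rs
    ... | no _  = restrict-all rs

    restrict-unique : ∀ {xs} → Unique Eq.setoid xs → Unique Sub.Eq.setoid (restrict xs)
    restrict-unique [] = []
    restrict-unique {x ∷ _} (x∉ ∷ u) with Q? x
    ... | yes _ = restrict-all x∉ ∷ restrict-unique u
    ... | no _  = restrict-unique u

    subposet : FinitePoset
    subposet = record
      { decPoset    = subDecPoset
      ; elements    = restrict elements
      ; enumeration = λ y → restrict-complete elements y (enumeration (proj₁ y))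
      ; unique      = restrict-unique unique
      ; 0̂           = m , Qm
      ; 0̂-minimum   = λ (x , q) → m-min x q
      }

------------------------------------------------------------------------

module _ (P : FinitePoset) where
  open FinitePoset P hiding (Carrier; 0̂; Atom; Ranked; rank; χ)
  open Subposet P using (subposet)

  lowerInterval : Carrier P → FinitePoset
  lowerInterval x = subposet (_≤? x) ≤-respˡ-≈ (0̂ P) (0̂-minimum x) (λ y _ → 0̂-minimum y)

  LocallyGeometric : Set
  LocallyGeometric = ∀ x → GeometricLattice (lowerInterval x)

  -- P″
  restriction : Carrier P → FinitePoset
  restriction a = subposet (a ≤?_) ≤-respʳ-≈ a refl (λ _ a≤x → a≤x)

  OtherAtom : Carrier P → Carrier P → Set
  OtherAtom a b = Atom P b × ¬ b ≈ a

  InDeletion : Carrier P → Pred (Carrier P) 0ℓ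
  InDeletion a x = x ≈ 0̂ P ⊎ ∃ λ T → T ≢ [] × All (OtherAtom a) T × x ∈⋁ T

  ∈⋁-resp : ∀ {T} → (_∈⋁ T) Respects _≈_
  ∈⋁-resp x≈y (ub , min) =
    All.map (≤-respʳ-≈ x≈y) ub , λ z ub′ z<y → min z ub′ (<-respʳ-≈ (Eq.sym x≈y) z<y)

  InDeletion-resp : ∀ a → InDeletion a Respects _≈_
  InDeletion-resp a x≈y (inj₁ x≈0)                = inj₁ (Eq.trans (Eq.sym x≈y) x≈0)
  InDeletion-resp a x≈y (inj₂ (T , ne , ats , j)) = inj₂ (T , ne , ats , ∈⋁-resp x≈y j)

  ∃? : (Q : Pred (Carrier P) 0ℓ) → Decidable Q → Q Respects _≈_ → Dec (∃ Q)
  ∃? Q Q? resp with any? Q? elements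
  ... | yes e = yes (Any.satisfied e)
  ... | no ¬e = no λ (x , q) → ¬e (Any.map (λ x≈y → resp x≈y q) (enumeration x))

  Between : Carrier P → Carrier P → Pred (Carrier P) 0ℓ
  Between x y z = x < z × z < y

  Between-resp : ∀ x y → Between x y Respects _≈_
  Between-resp x y z≈w (p , q) = <-respʳ-≈ z≈w p , <-respˡ-≈ z≈w q

  atom? : Decidable (Atom P)
  atom? a = 0̂ P <? a ×-dec
    ¬? (∃? (Between (0̂ P) a) (λ z → 0̂ P <? z ×-dec z <? a) (Between-resp (0̂ P) a))

  Atom-resp : Atom P Respects _≈_
  Atom-resp x≈y (p , c) =
    <-respʳ-≈ x≈y p , λ (z , q , r) → c (z , q , <-respʳ-≈ (Eq.sym x≈y) r)

  SmallerBound : List (Carrier P) → Carrier P → Pred (Carrier P) 0ℓ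
  SmallerBound T x y = UpperBound T y × y < x

  SmallerBound-resp : ∀ T x → SmallerBound T x Respects _≈_
  SmallerBound-resp T x y≈z (u , l) = All.map (≤-respʳ-≈ y≈z) u , <-respˡ-≈ y≈z l

  ∈⋁? : ∀ T → Decidable (_∈⋁ T)
  ∈⋁? T x with all? (_≤? x) T
            | ∃? (SmallerBound T x) (λ y → all? (_≤? y) T ×-dec y <? x) (SmallerBound-resp T x)
  ... | no ¬ub | _                = no λ (ub , _) → ¬ub ub
  ... | yes _  | yes (y , u , l)  = no λ (_ , min) → min y u l
  ... | yes ub | no ¬smaller      = yes (ub , λ y u l → ¬smaller (y , u , l))

  -- If x ∈⋁ T for some nonempty T ⊆ A∖{a}, then this holds for T the
  -- set of all atoms b ≤ x other than a.
  module _ (a x : Carrier P) where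
    Below : Pred (Carrier P) 0ℓ
    Below b = OtherAtom a b × b ≤ x

    below? : Decidable Below
    below? b = (atom? b ×-dec ¬? (b ≟ a)) ×-dec b ≤? x

    below-resp : Below Respects _≈_
    below-resp p ((at , ne) , le) =
      (Atom-resp p at , λ q → ne (Eq.trans p q)) , ≤-respˡ-≈ p le

    open Membership Eq.setoid using (_∈_)

    below : List (Carrier P)
    below = filter below? elements

    ∈-below : ∀ {b} → Below b → b ∈ below
    ∈-below {b} q = Membershipₚ.∈-filter⁺ Eq.setoid below? below-resp (enumeration b) q

    toBelow : ∀ {T} → All (OtherAtom a) T → UpperBound T x → All (_∈ below) T
    toBelow ats ub = All.map (λ {b} q → ∈-below {b} q) (All.zip (ats , ub))

    nonempty : ∀ {T} → T ≢ [] → All (_∈ below) T → below ≢ []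
    nonempty {[]}    ne _ _ = ne _≡_.refl
    nonempty {b ∷ T} ne (b∈ ∷ _) eq with below | b∈ | eq
    ... | [] | () | _

    ub-mono : ∀ {T} → All (_∈ below) T → ∀ {y} → UpperBound below y → UpperBound T y
    ub-mono T∈ {y} ub = All.map (λ b∈ → bound ub b∈) T∈
      where
      bound : ∀ {S b} → All (_≤ y) S → Any (b ≈_) S → b ≤ y
      bound (p ∷ _)  (here b≈c) = ≤-respˡ-≈ (Eq.sym b≈c) p
      bound (_ ∷ ps) (there i)  = bound ps i

    to : below ≢ [] × x ∈⋁ below → ∃ λ T → T ≢ [] × All (OtherAtom a) T × x ∈⋁ T
    to (ne , j) = below , ne , All.map proj₁ (all-filter below? elements) , j

    from : (∃ λ T → T ≢ [] × All (OtherAtom a) T × x ∈⋁ T) → below ≢ [] × x ∈⋁ below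
    from (T , ne , ats , ub , min) =
      nonempty ne T∈ ,
      All.map proj₂ (all-filter below? elements) ,
      λ y ub′ → min y (ub-mono T∈ ub′)
      where T∈ = toBelow ats ub

    nonempty? : (T : List (Carrier P)) → Dec (T ≢ [])
    nonempty? []      = no λ ne → ne _≡_.refl
    nonempty? (_ ∷ _) = yes λ ()

    inDeletion? : Dec (InDeletion a x)
    inDeletion? = x ≟ 0̂ P ⊎-dec map′ to from (nonempty? below ×-dec ∈⋁? below x)

  -- P′
  deletion : Carrier P → FinitePoset
  deletion a = subposet (inDeletion? a) (InDeletion-resp a)
                 (0̂ P) (inj₁ Eq.refl) (λ x _ → 0̂-minimum x)

  Separator : Carrier P → Set
  Separator a = rank P ∸ rank (deletion a) ≡ 1

------------------------------------------------------------------------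

data Inductive : FinitePoset → Set₁ where
  trivial : ∀ {P} → (∀ x → FinitePoset._≈_ P x (0̂ P)) → Inductive P
  step    : ∀ {P} → Ranked P → LocallyGeometric P →
            ∀ a → Atom P a →
            Inductive (deletion P a) → Inductive (restriction P a) →
            χ (restriction P a) ∣ₚ χ (deletion P a) →
            Inductive P

{-# OPTIONS --safe #-}
module Submission where

-- The Möbius functions satisfy μ(0̂,x) = [x ∈ P′] μ′(0̂,x) − [a ≤ x] μ″(a,x). Summing the right-hand
-- side over the elements below x gives [x̄ = 0̂] − [x = a], where x̄, the join in P_{≤x} of the atoms
-- other than a below x, is the largest element of P′ below x; since the atoms below x have join x,
-- x̄ = 0̂ exactly when x is 0̂ or a. Moreover rk′ = rk on P′ and rk″ = rk − 1 on P″, so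
-- χ_P = t^ε χ_P′ − χ_P″ with ε = rk P − rk P′ as soon as rk P″ = rk P − 1. P need not be pure, so this
-- last equality is not automatic, but it is forced by the sizes of the given multisets of roots.

open import Defs
open import Data.Nat.Base as ℕ using (ℕ; zero; suc; _∸_; _⊔_; z≤n; s≤s)
import Data.Nat.Properties as ℕₚ
open import Data.Integer.Base as ℤ using (ℤ; +_; 0ℤ; 1ℤ)
import Data.Integer.Properties as ℤₚ
open import Algebra.Properties.AbelianGroup ℤₚ.+-0-abelianGroup using (∙-cancelˡ)
open import Data.Integer.Solver using (module +-*-Solver)
open import Data.List.Base using (List; []; _∷_; _++_; [_]; map; foldr; length)
open import Data.List.Properties using (map-++; map-cong; length-map; length-++)
open import Data.List.Relation.Unary.All as All using (All; []; _∷_)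
import Data.List.Relation.Unary.All.Properties as Allₚ
open import Data.List.Relation.Unary.Any as Any using (Any; here; there)
open import Data.List.Relation.Unary.AllPairs using (AllPairs; []; _∷_)
open import Data.Product.Base using (Σ; ∃; _×_; _,_; proj₁; proj₂)
open import Data.Sum.Base using (_⊎_; inj₁; inj₂; [_,_]′)
open import Function.Base using (_∘_)
open import Function.Bundles using (module Equivalence)
open import Induction.WellFounded using (module All; module FixPoint)
import Relation.Binary.Construct.NonStrictToStrict as ToStrict
open import Relation.Binary.Lattice.Structures using (IsLattice)
open import Relation.Binary.Definitions using (_Respects_; tri<; tri≈; tri>)
open import Relation.Binary.PropositionalEquality using (_≡_; refl; sym; trans; cong; cong₂; subst; module ≡-Reasoning)
open import Relation.Nullary using (¬_; Dec; yes; no; _×-dec_; contradiction)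
open import Relation.Unary using (Pred; Decidable)
open import Level using (0ℓ)
open FinitePoset using (Carrier; Atom; Ranked)

-- Polynomials

infix 9 _·t

_·t : Poly → Poly
p ·t = 0ℤ ∷ p

∏t- : List ℤ → Poly
∏t- = foldr (λ r q → (t- r) *ₚ q) [ 1ℤ ]

coeff-+ₚ : ∀ p q k → coeff (p +ₚ q) k ≡ coeff p k ℤ.+ coeff q k
coeff-+ₚ []      q       k       = sym (ℤₚ.+-identityˡ _)
coeff-+ₚ (c ∷ p) []      k       = sym (ℤₚ.+-identityʳ _)
coeff-+ₚ (c ∷ p) (d ∷ q) zero    = refl
coeff-+ₚ (c ∷ p) (d ∷ q) (suc k) = coeff-+ₚ p q k

coeff-·ₚ : ∀ c p k → coeff (c ·ₚ p) k ≡ c ℤ.* coeff p k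
coeff-·ₚ c []      k       = sym (ℤₚ.*-zeroʳ c)
coeff-·ₚ c (d ∷ p) zero    = refl
coeff-·ₚ c (d ∷ p) (suc k) = coeff-·ₚ c p k

·t-cong : ∀ {p q} → p ≈ₚ q → p ·t ≈ₚ q ·t
·t-cong p≈q zero    = refl
·t-cong p≈q (suc k) = p≈q k

*ₚ-identityˡ : ∀ p → [ 1ℤ ] *ₚ p ≈ₚ p
*ₚ-identityˡ p k = begin
  coeff ((1ℤ ·ₚ p) +ₚ [] ·t) k          ≡⟨ coeff-+ₚ (1ℤ ·ₚ p) ([] ·t) k ⟩
  coeff (1ℤ ·ₚ p) k ℤ.+ coeff ([] ·t) k ≡⟨ cong₂ ℤ._+_ (coeff-·ₚ 1ℤ p k) (coeff-0 k) ⟩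
  1ℤ ℤ.* coeff p k ℤ.+ 0ℤ               ≡⟨ ℤₚ.+-identityʳ _ ⟩
  1ℤ ℤ.* coeff p k                      ≡⟨ ℤₚ.*-identityˡ _ ⟩
  coeff p k                             ∎
  where
  open ≡-Reasoning
  coeff-0 : ∀ k → coeff ([] ·t) k ≡ 0ℤ
  coeff-0 zero    = refl
  coeff-0 (suc k) = refl

-- Multiplying by a linear factor adds `-r` times `p` to the shift of `p`. All later polynomial
-- identities reduce through this formula to ring identities between integer coefficients.
coeff-t- : ∀ r p k → coeff ((t- r) *ₚ p) k ≡ (ℤ.- r) ℤ.* coeff p k ℤ.+ coeff (p ·t) k
coeff-t- r p k = begin
  coeff ((t- r) *ₚ p) k                                        ≡⟨ coeff-+ₚ ((ℤ.- r) ·ₚ p) (([ 1ℤ ] *ₚ p) ·t) k ⟩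
  coeff ((ℤ.- r) ·ₚ p) k ℤ.+ coeff (([ 1ℤ ] *ₚ p) ·t) k         ≡⟨ cong₂ ℤ._+_ (coeff-·ₚ (ℤ.- r) p k) (·t-cong (*ₚ-identityˡ p) k) ⟩
  (ℤ.- r) ℤ.* coeff p k ℤ.+ coeff (p ·t) k                     ∎
  where open ≡-Reasoning

t-*ₚ-congˡ : ∀ r {p q} → p ≈ₚ q → (t- r) *ₚ p ≈ₚ (t- r) *ₚ q
t-*ₚ-congˡ r {p} {q} p≈q k = begin
  coeff ((t- r) *ₚ p) k                     ≡⟨ coeff-t- r p k ⟩
  (ℤ.- r) ℤ.* coeff p k ℤ.+ coeff (p ·t) k  ≡⟨ cong₂ (λ u v → (ℤ.- r) ℤ.* u ℤ.+ v) (p≈q k) (·t-cong {p} {q} p≈q k) ⟩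
  (ℤ.- r) ℤ.* coeff q k ℤ.+ coeff (q ·t) k  ≡⟨ coeff-t- r q k ⟨
  coeff ((t- r) *ₚ q) k                     ∎
  where open ≡-Reasoning

-- Both products expand to integer expressions in the `k`-th coefficients of `p`, `p ·t` and
-- `p ·t ·t`, and these expressions are symmetric in `r` and `s`.
t-*ₚ-comm : ∀ r s p → (t- r) *ₚ ((t- s) *ₚ p) ≈ₚ (t- s) *ₚ ((t- r) *ₚ p)
t-*ₚ-comm r s p k = begin
  coeff ((t- r) *ₚ ((t- s) *ₚ p)) k                ≡⟨ expand r s k ⟩
  (ℤ.- r) ℤ.* ((ℤ.- s) ℤ.* p₀ k ℤ.+ p₁ k) ℤ.+ ((ℤ.- s) ℤ.* p₁ k ℤ.+ p₂ k)
    ≡⟨ solve 5 (λ r s x y z → (:- r) :* ((:- s) :* x :+ y) :+ ((:- s) :* y :+ z)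
                  := (:- s) :* ((:- r) :* x :+ y) :+ ((:- r) :* y :+ z)) refl r s (p₀ k) (p₁ k) (p₂ k) ⟩
  (ℤ.- s) ℤ.* ((ℤ.- r) ℤ.* p₀ k ℤ.+ p₁ k) ℤ.+ ((ℤ.- r) ℤ.* p₁ k ℤ.+ p₂ k)
    ≡⟨ expand s r k ⟨
  coeff ((t- s) *ₚ ((t- r) *ₚ p)) k                ∎
  where
  open ≡-Reasoning
  open +-*-Solver
  p₀ p₁ p₂ : ℕ → ℤ
  p₀ = coeff p
  p₁ = coeff (p ·t)
  p₂ = coeff (p ·t ·t)

  shifted : ∀ s k → coeff (((t- s) *ₚ p) ·t) k ≡ (ℤ.- s) ℤ.* p₁ k ℤ.+ p₂ k
  shifted s zero    = sym (cong (ℤ._+ 0ℤ) (ℤₚ.*-zeroʳ (ℤ.- s)))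
  shifted s (suc k) = coeff-t- s p k

  expand : ∀ r s k → coeff ((t- r) *ₚ ((t- s) *ₚ p)) k ≡
           (ℤ.- r) ℤ.* ((ℤ.- s) ℤ.* p₀ k ℤ.+ p₁ k) ℤ.+ ((ℤ.- s) ℤ.* p₁ k ℤ.+ p₂ k)
  expand r s k = trans (coeff-t- r ((t- s) *ₚ p) k)
    (cong₂ (λ u v → (ℤ.- r) ℤ.* u ℤ.+ v) (coeff-t- s p k) (shifted s k))

-- `∏t-` peels factors off the front, while the distinguished exponent stands at the end of its
-- list. Commuting it past the other factors brings it to the front.
∏t--∷ʳ : ∀ rs r → ∏t- (rs ++ [ r ]) ≈ₚ (t- r) *ₚ ∏t- rs
∏t--∷ʳ []       r k = refl
∏t--∷ʳ (s ∷ rs) r k =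
  trans (t-*ₚ-congˡ s {∏t- (rs ++ [ r ])} {(t- r) *ₚ ∏t- rs} (∏t--∷ʳ rs r) k) (t-*ₚ-comm s r (∏t- rs) k)

-- Monic polynomials and their multisets of roots.

record Monic (p : Poly) (n : ℕ) : Set where
  field
    leading : coeff p n ≡ 1ℤ
    above   : ∀ {k} → n ℕ.< k → coeff p k ≡ 0ℤ

open Monic

∏t--monic : ∀ rs → Monic (∏t- rs) (length rs)
∏t--monic []       .leading = refl
∏t--monic []       .above {suc k} _ = refl
∏t--monic (r ∷ rs) .leading = begin
  coeff (∏t- (r ∷ rs)) (suc (length rs))  ≡⟨ coeff-t- r (∏t- rs) (suc (length rs)) ⟩
  (ℤ.- r) ℤ.* coeff (∏t- rs) (suc (length rs)) ℤ.+ coeff (∏t- rs) (length rs)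
    ≡⟨ cong₂ (λ u v → (ℤ.- r) ℤ.* u ℤ.+ v) (∏t--monic rs .above ℕₚ.≤-refl) (∏t--monic rs .leading) ⟩
  (ℤ.- r) ℤ.* 0ℤ ℤ.+ 1ℤ                   ≡⟨ cong (ℤ._+ 1ℤ) (ℤₚ.*-zeroʳ (ℤ.- r)) ⟩
  1ℤ                                      ∎
  where open ≡-Reasoning
∏t--monic (r ∷ rs) .above {suc k} (s≤s rs<k) = begin
  coeff (∏t- (r ∷ rs)) (suc k)            ≡⟨ coeff-t- r (∏t- rs) (suc k) ⟩
  (ℤ.- r) ℤ.* coeff (∏t- rs) (suc k) ℤ.+ coeff (∏t- rs) k
    ≡⟨ cong₂ (λ u v → (ℤ.- r) ℤ.* u ℤ.+ v) (∏t--monic rs .above (ℕₚ.m<n⇒m<1+n rs<k)) (∏t--monic rs .above rs<k) ⟩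
  (ℤ.- r) ℤ.* 0ℤ ℤ.+ 0ℤ                   ≡⟨ cong (ℤ._+ 0ℤ) (ℤₚ.*-zeroʳ (ℤ.- r)) ⟩
  0ℤ                                      ∎
  where open ≡-Reasoning

1·ₚ : ∀ p → 1ℤ ·ₚ p ≈ₚ p
1·ₚ p k = trans (coeff-·ₚ 1ℤ p k) (ℤₚ.*-identityˡ _)

-- `HasRoots` permits any nonzero constant `c`. If `n < length rs`, then `c` would be a coefficient
-- of `p` above its degree, hence 0; if `n > length rs`, the leading coefficient 1 would be a
-- multiple of 0. So the degrees agree, and comparing leading coefficients gives `c ≡ 1`.
monic-HasRoots : ∀ {p n} rs → Monic p n → HasRoots p rs → n ≡ length rs × p ≈ₚ ∏t- rs
monic-HasRoots {p} {n} rs monic (c , c≢0 , p≈) =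
  n≡ , λ k → trans (p≈ k) (trans (cong (λ c → coeff (c ·ₚ ∏t- rs) k) c≡1) (1·ₚ (∏t- rs) k))
  where
  coeff-p : ∀ k → coeff p k ≡ c ℤ.* coeff (∏t- rs) k
  coeff-p k = trans (p≈ k) (coeff-·ₚ c (∏t- rs) k)

  c≡ : c ≡ coeff p (length rs)
  c≡ = sym (trans (coeff-p (length rs)) (trans (cong (c ℤ.*_) (∏t--monic rs .leading)) (ℤₚ.*-identityʳ c)))

  n≡ : n ≡ length rs
  n≡ with ℕₚ.<-cmp n (length rs)
  ... | tri< n< _ _ = contradiction (trans c≡ (monic .above n<)) c≢0
  ... | tri≈ _ n≡ _ = n≡
  ... | tri> _ _ n> = contradiction
    (trans (sym (monic .leading))
      (trans (coeff-p n) (trans (cong (c ℤ.*_) (∏t--monic rs .above n>)) (ℤₚ.*-zeroʳ c))))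
    λ ()

  c≡1 : c ≡ 1ℤ
  c≡1 = trans c≡ (trans (cong (coeff p) (sym n≡)) (monic .leading))

≈∏t-⇒HasRoots : ∀ {p} rs → p ≈ₚ ∏t- rs → HasRoots p rs
≈∏t-⇒HasRoots rs p≈ = 1ℤ , (λ ()) , λ k → trans (p≈ k) (sym (1·ₚ (∏t- rs) k))

-- Finite sums and maxima

-- Extension by zero: a sum over a decidable subset becomes a sum over the whole list. The value may
-- depend on the proof of membership, as it must for functions on a subposet.
guard : {A : Set} → Dec A → (A → ℤ) → ℤ
guard (yes a) f = f a
guard (no _)  f = 0ℤ

guard-cong : ∀ {A B : Set} {f : A → ℤ} {g : B → ℤ} (d : Dec A) (e : Dec B) →
             (A → B) → (B → A) → (∀ a b → f a ≡ g b) → guard d f ≡ guard e g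
guard-cong (yes a) (yes b) to from f≡g = f≡g a b
guard-cong (yes a) (no ¬b) to from f≡g = contradiction (to a) ¬b
guard-cong (no ¬a) (yes b) to from f≡g = contradiction (from b) ¬a
guard-cong (no _)  (no _)  to from f≡g = refl

guard-no : ∀ {A : Set} {f : A → ℤ} (d : Dec A) → ¬ A → guard d f ≡ 0ℤ
guard-no (yes a) ¬a = contradiction a ¬a
guard-no (no _)  ¬a = refl

guard-swap : ∀ {A B : Set} (d : Dec A) (e : Dec B) {f : B → ℤ} →
             guard d (λ _ → guard e f) ≡ guard e (λ b → guard d (λ _ → f b))
guard-swap (yes _) (yes _) = refl
guard-swap (yes _) (no _)  = refl
guard-swap (no _)  (yes _) = refl
guard-swap (no _)  (no _)  = refl

guard-- : ∀ {A : Set} (d : Dec A) u v →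
          guard d (λ _ → u ℤ.- v) ≡ guard d (λ _ → u) ℤ.- guard d (λ _ → v)
guard-- (yes _) u v = refl
guard-- (no _)  u v = refl

∑ : {A : Set} → List A → (A → ℤ) → ℤ
∑ xs f = foldr ℤ._+_ 0ℤ (map f xs)

syntax ∑ xs (λ x → e) = ∑[ x ∈ xs ] e

module _ {A : Set} {f g : A → ℤ} where
  ∑-cong : (∀ x → f x ≡ g x) → ∀ xs → ∑ xs f ≡ ∑ xs g
  ∑-cong f≡g []       = refl
  ∑-cong f≡g (x ∷ xs) = cong₂ ℤ._+_ (f≡g x) (∑-cong f≡g xs)

  ∑-+ : ∀ xs → ∑[ x ∈ xs ] (f x ℤ.+ g x) ≡ ∑ xs f ℤ.+ ∑ xs g
  ∑-+ []       = refl
  ∑-+ (x ∷ xs) = trans (cong (λ s → f x ℤ.+ g x ℤ.+ s) (∑-+ xs))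
    (solve 4 (λ a b c d → a :+ b :+ (c :+ d) := a :+ c :+ (b :+ d)) refl (f x) (g x) (∑ xs f) (∑ xs g))
    where open +-*-Solver

  ∑-- : ∀ xs → ∑[ x ∈ xs ] (f x ℤ.- g x) ≡ ∑ xs f ℤ.- ∑ xs g
  ∑-- []       = refl
  ∑-- (x ∷ xs) = trans (cong (λ s → f x ℤ.- g x ℤ.+ s) (∑-- xs))
    (solve 4 (λ a b c d → a :- b :+ (c :- d) := a :+ c :- (b :+ d)) refl (f x) (g x) (∑ xs f) (∑ xs g))
    where open +-*-Solver

∑-zero : ∀ {A : Set} {f : A → ℤ} {xs} → All (λ x → f x ≡ 0ℤ) xs → ∑ xs f ≡ 0ℤ
∑-zero []       = refl
∑-zero (z ∷ zs) = cong₂ ℤ._+_ z (∑-zero zs)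

maxOver : {A : Set} → List A → (A → ℕ) → ℕ
maxOver xs f = foldr _⊔_ 0 (map f xs)

module _ {A : Set} (f : A → ℕ) where
  ≤-maxOver : ∀ {n xs} → Any (λ x → n ℕ.≤ f x) xs → n ℕ.≤ maxOver xs f
  ≤-maxOver (here n≤) = ℕₚ.m≤n⇒m≤n⊔o _ n≤
  ≤-maxOver (there i) = ℕₚ.m≤n⇒m≤o⊔n _ (≤-maxOver i)

  maxOver-attained : ∀ xs → maxOver xs f ≡ 0 ⊎ ∃ λ x → maxOver xs f ≡ f x
  maxOver-attained []       = inj₁ refl
  maxOver-attained (x ∷ xs) with ℕₚ.⊔-sel (f x) (maxOver xs f) | maxOver-attained xs
  ... | inj₁ e | _              = inj₂ (x , e)
  ... | inj₂ e | inj₁ e′        = inj₁ (trans e e′)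
  ... | inj₂ e | inj₂ (y , e′)  = inj₂ (y , trans e e′)

-- General facts on finite posets

module PosetProperties (P : FinitePoset) where
  open FinitePoset P renaming (refl to ≤-refl; trans to ≤-trans) hiding (Carrier; Atom; Ranked)

  if-yes-ext : ∀ {A B : Set} (d : Dec A) {f g : A → B} {b : B} →
               (∀ a → f a ≡ g a) → if-yes d f b ≡ if-yes d g b
  if-yes-ext (yes a) f≡g = f≡g a
  if-yes-ext (no _)  f≡g = refl

  if-yes-guard : ∀ {A : Set} (d : Dec A) {f : A → ℤ} → if-yes d f 0ℤ ≡ guard d f
  if-yes-guard (yes _) = refl
  if-yes-guard (no _)  = refl

  <⇒≱ : ∀ {x y} → x < y → ¬ y ≤ x
  <⇒≱ = ToStrict.<⇒≱ _≈_ _≤_ antisym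

  <-≤-trans : ∀ {x y z} → x < y → y ≤ z → x < z
  <-≤-trans = ToStrict.<-≤-trans _≈_ _≤_ Eq.sym ≤-trans antisym ≤-respʳ-≈

  ≤∧≮⇒≈ : ∀ {x y} → x ≤ y → ¬ x < y → x ≈ y
  ≤∧≮⇒≈ {x} {y} x≤y x≮y with x ≟ y
  ... | yes x≈y = x≈y
  ... | no  x≉y = contradiction (x≤y , x≉y) x≮y

  <0̂-absurd : ∀ {x} → ¬ x < 0̂
  <0̂-absurd x<0 = <⇒≱ x<0 (0̂-minimum _)

  ≤0̂⇒≈0̂ : ∀ {x} → x ≤ 0̂ → x ≈ 0̂
  ≤0̂⇒≈0̂ x≤0 = antisym x≤0 (0̂-minimum _)

  ≉0̂⇒0̂< : ∀ {x} → ¬ x ≈ 0̂ → 0̂ < x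
  ≉0̂⇒0̂< x≉0 = 0̂-minimum _ , x≉0 ∘ Eq.sym

  ⋖-respʳ-≈ : ∀ {x} → (x ⋖_) Respects _≈_
  ⋖-respʳ-≈ y≈z (x<y , none) =
    <-respʳ-≈ y≈z x<y , λ (w , x<w , w<z) → none (w , x<w , <-respʳ-≈ (Eq.sym y≈z) w<z)

  -- The existence lemmas are opaque because with-abstraction would normalise them.
  opaque
    cover-below : ∀ {x} y → x < y → ∃ λ z → x ⋖ z × z ≤ y
    cover-below {x} = All.wfRec <-wellFounded 0ℓ _ go
      where
      go : ∀ y → (∀ {z} → z < y → x < z → ∃ λ w → x ⋖ w × w ≤ z) → x < y → ∃ λ w → x ⋖ w × w ≤ y
      go y rec x<y with ∃? P (Between P x y) (λ z → x <? z ×-dec z <? y) (Between-resp P x y)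
      ... | no  none = y , (x<y , none) , ≤-refl
      ... | yes (z , x<z , z<y) =
        let w , x⋖w , w≤z = rec z<y x<z in w , x⋖w , ≤-trans w≤z (proj₁ z<y)

  -- The enumeration contains a representative of the class of `x`, and by `unique` only one, so a
  -- single term survives.
  ∑-≈ : ∀ {f : Carrier P → ℤ} x → (∀ {y} → y ≈ x → f y ≡ f x) →
        ∑[ y ∈ elements ] guard (y ≟ x) (λ _ → f y) ≡ f x
  ∑-≈ {f} x f-cong = go unique (enumeration x)
    where
    go : ∀ {ys} → AllPairs (λ y z → ¬ y ≈ z) ys → Any (x ≈_) ys → ∑[ y ∈ ys ] guard (y ≟ x) (λ _ → f y) ≡ f x
    go {y ∷ ys} (y≉ ∷ u) i with y ≟ x
    ... | yes y≈x = trans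
      (cong₂ ℤ._+_ (f-cong y≈x)
        (∑-zero (All.map (λ y≉z → guard-no (_ ≟ x) (λ z≈x → y≉z (Eq.trans y≈x (Eq.sym z≈x)))) y≉)))
      (ℤₚ.+-identityʳ _)
    go {y ∷ ys} (y≉ ∷ u) (here x≈y) | no y≉x = contradiction (Eq.sym x≈y) y≉x
    go {y ∷ ys} (y≉ ∷ u) (there i)  | no y≉x = trans (ℤₚ.+-identityˡ _) (go u i)

  ∑≤ ∑< : (Carrier P → ℤ) → Carrier P → ℤ
  ∑≤ f x = ∑[ y ∈ elements ] guard (y ≤? x) (λ _ → f y)
  ∑< f x = ∑[ y ∈ elements ] guard (y <? x) (λ _ → f y)

  ∑-≤ : ∀ {f : Carrier P → ℤ} x → (∀ {y} → y ≈ x → f y ≡ f x) →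
        ∑≤ f x ≡ ∑< f x ℤ.+ f x
  ∑-≤ {f} x f-cong = begin
    ∑≤ f x
      ≡⟨ ∑-cong (λ y → trichotomy (y ≤? x) (y <? x) (y ≟ x)) elements ⟩
    ∑[ y ∈ elements ] (guard (y <? x) (λ _ → f y) ℤ.+ guard (y ≟ x) (λ _ → f y))
      ≡⟨ ∑-+ elements ⟩
    ∑< f x ℤ.+ ∑[ y ∈ elements ] guard (y ≟ x) (λ _ → f y)
      ≡⟨ cong (λ s → ∑< f x ℤ.+ s) (∑-≈ x f-cong) ⟩
    ∑< f x ℤ.+ f x
      ∎
    where
    open ≡-Reasoning
    trichotomy : ∀ {y v} (d : Dec (y ≤ x)) (e : Dec (y < x)) (e′ : Dec (y ≈ x)) →
                 guard d (λ _ → v) ≡ guard e (λ _ → v) ℤ.+ guard e′ (λ _ → v)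
    trichotomy d         (yes y<x) (yes y≈x) = contradiction y≈x (proj₂ y<x)
    trichotomy (yes _)   (yes _)   (no _)    = sym (ℤₚ.+-identityʳ _)
    trichotomy (yes _)   (no _)    (yes _)   = sym (ℤₚ.+-identityˡ _)
    trichotomy (yes y≤x) (no y≮x)  (no y≉x)  = contradiction (y≤x , y≉x) y≮x
    trichotomy (no y≰x)  (yes y<x) (no _)    = contradiction (proj₁ y<x) y≰x
    trichotomy (no y≰x)  (no _)    (yes y≈x) = contradiction (reflexive y≈x) y≰x
    trichotomy (no _)    (no _)    (no _)    = refl

  -- The Möbius function from the least element.

  μ-unfold : ∀ x y → μ x y ≡ if-yes (x ≟ y) (λ _ → 1ℤ)
    (ℤ.- ∑[ z ∈ elements ] if-yes (x ≤? z ×-dec z <? y) (λ _ → μ x z) 0ℤ)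
  μ-unfold x y = FixPoint.unfold-wfRec <-wellFounded (λ _ → ℤ) body body-ext
    where
    -- A copy of the functional that defines `μ`; `body-ext` is the extensionality needed to unfold
    -- a well-founded fixed point.
    body : ∀ y → (∀ {z} → z < y → ℤ) → ℤ
    body y rec = if-yes (x ≟ y) (λ _ → 1ℤ)
      (ℤ.- ∑[ z ∈ elements ] if-yes (x ≤? z ×-dec z <? y) (λ (_ , z<y) → rec z<y) 0ℤ)

    body-ext : ∀ y {rec rec′ : ∀ {z} → z < y → ℤ} →
               (∀ {z} (z<y : z < y) → rec z<y ≡ rec′ z<y) → body y rec ≡ body y rec′
    body-ext y rec≡ = cong (λ s → if-yes (x ≟ y) (λ _ → 1ℤ) (ℤ.- s))
      (∑-cong (λ z → if-yes-ext (x ≤? z ×-dec z <? y) (λ (_ , z<y) → rec≡ z<y)) elements)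

  μ-0̂ : ∀ {x} → x ≈ 0̂ → μ 0̂ x ≡ 1ℤ
  μ-0̂ {x} x≈0 with 0̂ ≟ x | μ-unfold 0̂ x
  ... | yes _   | e = e
  ... | no  0≉x | e = contradiction (Eq.sym x≈0) 0≉x

  μ-≉0̂ : ∀ {x} → ¬ x ≈ 0̂ → μ 0̂ x ≡ ℤ.- ∑< (μ 0̂) x
  μ-≉0̂ {x} x≉0 with 0̂ ≟ x | μ-unfold 0̂ x
  ... | yes 0≈x | e = contradiction (Eq.sym 0≈x) x≉0
  ... | no  _   | e = trans e (cong ℤ.-_ (∑-cong (λ y →
    trans (if-yes-guard (0̂ ≤? y ×-dec y <? x))
      (guard-cong (0̂ ≤? y ×-dec y <? x) (y <? x) proj₂ (0̂-minimum y ,_) (λ _ _ → refl))) elements))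

  μ-cong : ∀ {x y} → x ≈ y → μ 0̂ x ≡ μ 0̂ y
  μ-cong {x} {y} x≈y with x ≟ 0̂
  ... | yes x≈0 = trans (μ-0̂ x≈0) (sym (μ-0̂ (Eq.trans (Eq.sym x≈y) x≈0)))
  ... | no  x≉0 = trans (μ-≉0̂ x≉0) (trans
    (cong ℤ.-_ (∑-cong (λ z → guard-cong (z <? x) (z <? y) (<-respʳ-≈ x≈y) (<-respʳ-≈ (Eq.sym x≈y)) (λ _ _ → refl)) elements))
    (sym (μ-≉0̂ (x≉0 ∘ Eq.trans x≈y))))

  δ : Carrier P → ℤ
  δ x = guard (x ≟ 0̂) (λ _ → 1ℤ)

  ∑-μ : ∀ x → ∑≤ (μ 0̂) x ≡ δ x
  ∑-μ x = trans (∑-≤ x μ-cong) (go (x ≟ 0̂))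
    where
    go : (d : Dec (x ≈ 0̂)) → ∑< (μ 0̂) x ℤ.+ μ 0̂ x ≡ guard d (λ _ → 1ℤ)
    go (yes x≈0) = cong₂ ℤ._+_
      (∑-zero (All.universal (λ y → guard-no (y <? x) (λ y<x → <0̂-absurd (<-respʳ-≈ x≈0 y<x))) elements))
      (μ-0̂ x≈0)
    go (no x≉0) = trans (cong (λ s → ∑< (μ 0̂) x ℤ.+ s) (μ-≉0̂ x≉0)) (ℤₚ.+-inverseʳ (∑< (μ 0̂) x))

  -- By well-founded induction the two sums over the elements strictly below `x` agree; cancelling
  -- them leaves the values at `x`. A formula for `μ 0̂` can thus be verified through its sums over
  -- lower sets.
  μ-unique : (f : Carrier P → ℤ) → (∀ {x y} → x ≈ y → f x ≡ f y) →
             (∀ x → ∑≤ f x ≡ δ x) → ∀ x → μ 0̂ x ≡ f x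
  μ-unique f f-cong ∑-f = All.wfRec <-wellFounded 0ℓ _ go
    where
    open ≡-Reasoning
    go : ∀ x → (∀ {y} → y < x → μ 0̂ y ≡ f y) → μ 0̂ x ≡ f x
    go x rec = ∙-cancelˡ (∑< (μ 0̂) x) _ _ (begin
      ∑< (μ 0̂) x ℤ.+ μ 0̂ x ≡⟨ ∑-≤ x μ-cong ⟨
      ∑≤ (μ 0̂) x           ≡⟨ ∑-μ x ⟩
      δ x                  ≡⟨ ∑-f x ⟨
      ∑≤ f x               ≡⟨ ∑-≤ x f-cong ⟩
      ∑< f x ℤ.+ f x       ≡⟨ cong (ℤ._+ f x) (∑-cong (λ y → guard-ext (y <? x) rec) elements) ⟨
      ∑< (μ 0̂) x ℤ.+ f x   ∎)
      where
      guard-ext : ∀ {A : Set} (d : Dec A) {u v : ℤ} → (A → u ≡ v) → guard d (λ _ → u) ≡ guard d (λ _ → v)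
      guard-ext (yes a) u≡v = u≡v a
      guard-ext (no _)  u≡v = refl

  -- The rank function and maximal chains.

  rk-unfold : ∀ x → rk x ≡ maxOver elements (λ y → if-yes (y <? x) (λ _ → suc (rk y)) 0)
  rk-unfold x = FixPoint.unfold-wfRec <-wellFounded (λ _ → ℕ) body body-ext {x}
    where
    body : ∀ x → (∀ {y} → y < x → ℕ) → ℕ
    body x rec = maxOver elements (λ y → if-yes (y <? x) (λ y<x → suc (rec y<x)) 0)

    body-ext : ∀ x {rec rec′ : ∀ {y} → y < x → ℕ} →
               (∀ {y} (y<x : y < x) → rec y<x ≡ rec′ y<x) → body x rec ≡ body x rec′
    body-ext x rec≡ = cong (foldr _⊔_ 0)
      (map-cong (λ y → if-yes-ext (y <? x) (λ y<x → cong suc (rec≡ y<x))) elements)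

  rk-attained : ∀ x → rk x ≡ 0 ⊎ ∃ λ y → y < x × rk x ≡ suc (rk y)
  rk-attained x with maxOver-attained (λ y → if-yes (y <? x) (λ _ → suc (rk y)) 0) elements
  ... | inj₁ e = inj₁ (trans (rk-unfold x) e)
  ... | inj₂ (y , e) with y <? x
  ...   | yes y<x = inj₂ (y , y<x , trans (rk-unfold x) e)
  ...   | no  _   = inj₁ (trans (rk-unfold x) e)

  rk-cong : ∀ {x y} → x ≈ y → rk x ≡ rk y
  rk-cong {x} {y} x≈y = trans (rk-unfold x) (trans
    (cong (foldr _⊔_ 0) (map-cong (λ z → if-yes-⇔ (z <? x) (z <? y) (<-respʳ-≈ x≈y) (<-respʳ-≈ (Eq.sym x≈y))) elements))
    (sym (rk-unfold y)))
    where
    if-yes-⇔ : ∀ {A B : Set} (d : Dec A) (e : Dec B) {n : ℕ} → (A → B) → (B → A) →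
               if-yes d (λ _ → n) 0 ≡ if-yes e (λ _ → n) 0
    if-yes-⇔ (yes _) (yes _) to from = refl
    if-yes-⇔ (yes a) (no ¬b) to from = contradiction (to a) ¬b
    if-yes-⇔ (no ¬a) (yes b) to from = contradiction (from b) ¬a
    if-yes-⇔ (no _)  (no _)  to from = refl

  rk-mono-< : ∀ {x y} → x < y → rk x ℕ.< rk y
  rk-mono-< {x} {y} x<y = subst (rk x ℕ.<_) (sym (rk-unfold y))
    (≤-maxOver _ (Any.map representative (enumeration x)))
    where
    -- The enumeration meets `x` only up to `≈`, so the bound is read off at an equivalent `z`.
    representative : ∀ {z} → x ≈ z → suc (rk x) ℕ.≤ if-yes (z <? y) (λ _ → suc (rk z)) 0
    representative {z} x≈z with z <? y
    ... | yes _   = ℕₚ.≤-reflexive (cong suc (rk-cong x≈z))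
    ... | no  z≮y = contradiction (<-respˡ-≈ x≈z x<y) z≮y

  rk≤rank : ∀ x → rk x ℕ.≤ rank
  rk≤rank x = ≤-maxOver rk (Any.map (ℕₚ.≤-reflexive ∘ rk-cong) (enumeration x))

  rk-0̂ : ∀ {x} → x ≈ 0̂ → rk x ≡ 0
  rk-0̂ {x} x≈0 with rk-attained x
  ... | inj₁ e             = e
  ... | inj₂ (y , y<x , _) = contradiction (<-respʳ-≈ x≈0 y<x) <0̂-absurd

  rk≡0⇒≈0̂ : ∀ {x} → rk x ≡ 0 → x ≈ 0̂
  rk≡0⇒≈0̂ {x} e with x ≟ 0̂
  ... | yes x≈0 = x≈0
  ... | no  x≉0 with rk x | e | rk-mono-< (≉0̂⇒0̂< x≉0)
  ...   | _ | refl | ()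

  rank-attained : ∃ λ x → rank ≡ rk x
  rank-attained with maxOver-attained rk elements
  ... | inj₁ e = 0̂ , trans e (sym (rk-0̂ Eq.refl))
  ... | inj₂ p = p

  -- A `y` below `x` with `rk x ≡ suc (rk y)` is covered by `x`, because an element strictly between
  -- would have a rank strictly between two consecutive numbers. Iterating gives a maximal chain of
  -- length `rk x`; in a ranked poset every maximal chain ending at `x` then has this length.
  maximalChain : ∀ x → MaximalChain x (rk x)
  maximalChain = All.wfRec <-wellFounded 0ℓ _ go
    where
    go : ∀ x → (∀ {y} → y < x → MaximalChain y (rk y)) → MaximalChain x (rk x)
    go x rec with rk-attained x
    ... | inj₁ e = subst (MaximalChain x) (sym e) (start (rk≡0⇒≈0̂ e))
    ... | inj₂ (y , y<x , e) = subst (MaximalChain x) (sym e) (extend (rec y<x) (y<x , none))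
      where
      none : ¬ ∃ (Between P y x)
      none (z , y<z , z<x) = ℕₚ.<⇒≱ (ℕₚ.<-≤-trans (s≤s (rk-mono-< y<z)) (rk-mono-< z<x)) (ℕₚ.≤-reflexive e)

  module _ (ranked : FinitePoset.Ranked P) where
    maximalChain-rk : ∀ {x n} → MaximalChain x n → n ≡ rk x
    maximalChain-rk {x} c = ranked x c (maximalChain x)

    ⋖-rk : ∀ {x y} → x ⋖ y → rk y ≡ suc (rk x)
    ⋖-rk {x} x⋖y = sym (maximalChain-rk (extend (maximalChain x) x⋖y))

  -- Coefficients and degree of the characteristic polynomial.

  coeff-χ : ∀ k → coeff χ k ≡ ∑[ x ∈ elements ] guard (rank ∸ rk x ℕₚ.≟ k) (λ _ → μ 0̂ x)
  coeff-χ k = go elements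
    where
    coeff-monomial : ∀ c m k → coeff (monomial c m) k ≡ guard (m ℕₚ.≟ k) (λ _ → c)
    coeff-monomial c zero    zero    = refl
    coeff-monomial c zero    (suc k) = refl
    coeff-monomial c (suc m) zero    = refl
    coeff-monomial c (suc m) (suc k) = trans (coeff-monomial c m k)
      (guard-cong (m ℕₚ.≟ k) (suc m ℕₚ.≟ suc k) (cong suc) ℕₚ.suc-injective (λ _ _ → refl))

    term : Carrier P → Poly
    term x = monomial (μ 0̂ x) (rank ∸ rk x)

    go : ∀ xs → coeff (sumₚ (map term xs)) k ≡ ∑[ x ∈ xs ] guard (rank ∸ rk x ℕₚ.≟ k) (λ _ → μ 0̂ x)
    go []       = refl
    go (x ∷ xs) = trans (coeff-+ₚ (term x) (sumₚ (map term xs)) k)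
      (cong₂ ℤ._+_ (coeff-monomial (μ 0̂ x) (rank ∸ rk x) k) (go xs))

  -- Only elements of rank 0 contribute in degree `rank`, and these are the copies of `0̂`, where
  -- the Möbius value is 1. Hence the number of roots of a factorable poset is its rank.
  χ-monic : Monic χ rank
  χ-monic .leading = begin
    coeff χ rank                                                        ≡⟨ coeff-χ rank ⟩
    ∑[ x ∈ elements ] guard (rank ∸ rk x ℕₚ.≟ rank) (λ _ → μ 0̂ x)
      ≡⟨ ∑-cong (λ x → guard-cong (rank ∸ rk x ℕₚ.≟ rank) (x ≟ 0̂) (⇒≈0̂ x) ≈0̂⇒ (λ _ _ → refl)) elements ⟩
    ∑[ x ∈ elements ] guard (x ≟ 0̂) (λ _ → μ 0̂ x)                       ≡⟨ ∑-≈ 0̂ μ-cong ⟩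
    μ 0̂ 0̂                                                               ≡⟨ μ-0̂ Eq.refl ⟩
    1ℤ                                                                  ∎
    where
    open ≡-Reasoning
    ⇒≈0̂ : ∀ x → rank ∸ rk x ≡ rank → x ≈ 0̂
    ⇒≈0̂ x e = rk≡0⇒≈0̂ (ℕₚ.+-cancelˡ-≡ rank (rk x) 0
      (trans (cong (ℕ._+ rk x) (sym e)) (trans (ℕₚ.m∸n+n≡m (rk≤rank x)) (sym (ℕₚ.+-identityʳ rank)))))

    ≈0̂⇒ : ∀ {x} → x ≈ 0̂ → rank ∸ rk x ≡ rank
    ≈0̂⇒ x≈0 = cong (rank ∸_) (rk-0̂ x≈0)
  χ-monic .above {k} rank<k = trans (coeff-χ k)
    (∑-zero (All.universal (λ x → guard-no (rank ∸ rk x ℕₚ.≟ k)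
      (λ e → ℕₚ.<⇒≱ rank<k (subst (ℕ._≤ rank) e (ℕₚ.m∸n≤m rank (rk x))))) elements))

∑-restrict : ∀ (P : FinitePoset) {Q : Pred (Carrier P) 0ℓ} (Q? : Decidable Q)
             (Q-resp : Q Respects FinitePoset._≈_ P) (m : Carrier P) (Qm : Q m)
             (m-min : ∀ x → Q x → FinitePoset._≤_ P m x)
             (f : Σ (Carrier P) Q → ℤ) xs →
             ∑ (Subposet.restrict P Q? Q-resp m Qm m-min xs) f ≡
             ∑[ x ∈ xs ] guard (Q? x) (λ q → f (x , q))
∑-restrict P Q? Q-resp m Qm m-min f []       = refl
∑-restrict P Q? Q-resp m Qm m-min f (x ∷ xs) with Q? x
... | yes q = cong (λ s → f (x , q) ℤ.+ s) (∑-restrict P Q? Q-resp m Qm m-min f xs)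
... | no _  = trans (∑-restrict P Q? Q-resp m Qm m-min f xs) (sym (ℤₚ.+-identityˡ _))

-- Joins in the lower intervals of a locally geometric poset

module LocallyGeometricProperties (P : FinitePoset) (geometric : LocallyGeometric P) where
  open FinitePoset P renaming (refl to ≤-refl; trans to ≤-trans) hiding (Carrier; Atom; Ranked)
  open PosetProperties P

  -- The least upper bound inside the interval below `x`. It is taken relative to `x` because in the
  -- whole poset `T` may have several minimal upper bounds, or none.
  IsJoin : Carrier P → List (Carrier P) → Carrier P → Set
  IsJoin x T j = j ≤ x × UpperBound T j × (∀ z → z ≤ x → UpperBound T z → j ≤ z)

  IsJoin-unique : ∀ {x T i j} → IsJoin x T i → IsJoin x T j → i ≈ j
  IsJoin-unique (i≤x , ubᵢ , leastᵢ) (j≤x , ubⱼ , leastⱼ) =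
    antisym (leastᵢ _ j≤x ubⱼ) (leastⱼ _ i≤x ubᵢ)

  opaque
    -- This is the join of the lattice `lowerInterval P x`, and the last component is its geometric
    -- covering property. A cover in the interval is a cover in `P`, since whatever lies below `w`
    -- also lies below `x`.
    binaryJoin : ∀ {x u v} → u ≤ x → v ≤ x → ∃ λ w →
                 (w ≤ x × u ≤ w × v ≤ w × (∀ z → z ≤ x → u ≤ z → v ≤ z → w ≤ z)) ×
                 (Atom P v → ¬ v ≤ u → u ⋖ w)
    binaryJoin {x} {u} {v} u≤x v≤x =
      w , (w≤x , x≤x∨y u′ v′ , y≤x∨y u′ v′ , λ z z≤x u≤z v≤z → ∨-least {u′} {v′} {z , z≤x} u≤z v≤z) , cover
      where
      module L = FinitePoset (lowerInterval P x)
      open GeometricLattice (geometric x)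
      open IsLattice isLattice using (x≤x∨y; y≤x∨y; ∨-least)
      u′ v′ : L.Carrier
      u′ = u , u≤x
      v′ = v , v≤x
      w : Carrier P
      w = proj₁ (u′ ∨ v′)
      w≤x : w ≤ x
      w≤x = proj₂ (u′ ∨ v′)

      cover : Atom P v → ¬ v ≤ u → u ⋖ w
      cover (0<v , none) v≰u =
        let u<w , none′ = Equivalence.from (covers u′ (u′ ∨ v′))
              (v′ , (0<v , λ ((z , _) , p , q) → none (z , p , q)) , v≰u , Eq.refl)
        in u<w , λ (z , u<z , z<w) → none′ ((z , ≤-trans (proj₁ z<w) w≤x) , u<z , z<w)

    -- Choose a cover `z` of `u` with `z ≤ y`. Geometricity of the interval below `z` makes `z` the
    -- join of `u` with an atom not below `u`. Consequently elements of an interval are told apart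
    -- by the atoms below them.
    separatingAtom : ∀ {u y} → u < y → ∃ λ b → Atom P b × b ≤ y × ¬ b ≤ u
    separatingAtom {u} {y} u<y with cover-below y u<y
    ... | z , (u<z , none) , z≤y =
      let (b , b≤z) , (0<b , none′) , b≰u , _ = Equivalence.to (covers (u , proj₁ u<z) (z , ≤-refl))
            (u<z , λ ((w , _) , p , q) → none (w , p , q))
      in b , (0<b , λ (w , p , q) → none′ ((w , ≤-trans (proj₁ q) b≤z) , p , q)) , ≤-trans b≤z z≤y , b≰u
      where open GeometricLattice (geometric z)

    join : ∀ x T → UpperBound T x → ∃ (IsJoin x T)
    join x []      []         = 0̂ , 0̂-minimum x , [] , λ z _ _ → 0̂-minimum z
    join x (v ∷ T) (v≤x ∷ ub) with join x T ub
    ... | j , j≤x , ubⱼ , least with binaryJoin j≤x v≤x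
    ...   | w , (w≤x , j≤w , v≤w , leastʷ) , _ =
      w , w≤x , v≤w ∷ All.map (λ t≤j → ≤-trans t≤j j≤w) ubⱼ ,
      λ { z z≤x (v≤z ∷ ub′) → leastʷ z z≤x (least z z≤x ub′) v≤z }

  -- Remove one atom `v` and let `i` be the join of the rest. If `v ≤ i`, then `v` is redundant and
  -- the recursion continues; otherwise joining `v` to `i` is a covering step. This lets one descend
  -- by covers without leaving the joins of atoms from `R`.
  coveredByJoin : ∀ (R : Pred (Carrier P) 0ℓ) → (∀ {b} → R b → Atom P b) →
                  ∀ {x j} T → All R T → UpperBound T x → IsJoin x T j →
                  j ≈ 0̂ ⊎ ∃ λ S → All R S × ∃ λ i → IsJoin x S i × i ⋖ j
  coveredByJoin R R⇒Atom [] _ _ (_ , _ , least) = inj₁ (≤0̂⇒≈0̂ (least 0̂ (0̂-minimum _) []))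
  coveredByJoin R R⇒Atom {x} {j} (v ∷ T) (Rv ∷ RT) (v≤x ∷ ub) isJoin@(j≤x , v≤j ∷ ubⱼ , least)
    with join x T ub
  ... | i , isJoinᵢ@(i≤x , ubᵢ , leastᵢ) with v ≤? i
  ...   | yes v≤i = coveredByJoin R R⇒Atom T RT ub
          (j≤x , ubⱼ , λ z z≤x ub′ → least z z≤x (≤-trans v≤i (leastᵢ z z≤x ub′) ∷ ub′))
  ...   | no  v≰i with binaryJoin i≤x v≤x
  ...     | w , (w≤x , i≤w , v≤w , leastʷ) , cover =
    inj₂ (T , RT , i , isJoinᵢ , ⋖-respʳ-≈ (IsJoin-unique isJoinʷ isJoin) (cover (R⇒Atom Rv) v≰i))
    where
    isJoinʷ : IsJoin x (v ∷ T) w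
    isJoinʷ = w≤x , v≤w ∷ All.map (λ t≤i → ≤-trans t≤i i≤w) ubᵢ ,
      λ { z z≤x (v≤z ∷ ub′) → leastʷ z z≤x (leastᵢ z z≤x ub′) v≤z }

  IsJoin⇒∈⋁ : ∀ {x T j} → IsJoin x T j → j ∈⋁ T
  IsJoin⇒∈⋁ (j≤x , ub , least) = ub , λ y ub′ y<j → <⇒≱ y<j (least y (≤-trans (proj₁ y<j) j≤x) ub′)

  -- The join `j` of `T` in the interval is an upper bound with `j ≤ z`, so minimality of `z` forces
  -- `j ≈ z`.
  ∈⋁⇒IsJoin : ∀ {x T z} → z ≤ x → z ∈⋁ T → IsJoin x T z
  ∈⋁⇒IsJoin {x} {T} {z} z≤x (ub , min) with join x T (All.map (λ t≤z → ≤-trans t≤z z≤x) ub)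
  ... | j , j≤x , ubⱼ , least = z≤x , ub , λ y y≤x ub′ → ≤-trans (reflexive (Eq.sym j≈z)) (least y y≤x ub′)
    where
    j≈z : j ≈ z
    j≈z = ≤∧≮⇒≈ (least z z≤x ub) (min j ubⱼ)

-- Deletion and restriction at an atom, and the closure into the deletion.

module DeletionRestriction (P : FinitePoset) (ranked : Ranked P) (geometric : LocallyGeometric P)
                           (a : Carrier P) (atom-a : Atom P a) where
  open FinitePoset P renaming (refl to ≤-refl; trans to ≤-trans) hiding (Carrier; Atom; Ranked)
  open PosetProperties P
  open LocallyGeometricProperties P geometric

  P′ P″ : FinitePoset
  P′ = deletion P a
  P″ = restriction P a

  module P′ where
    open FinitePoset P′ public
    open PosetProperties P′ public

  module P″ where
    open FinitePoset P″ public
    open PosetProperties P″ public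

  atoms-incomparable : ∀ {b c} → Atom P b → Atom P c → b ≤ c → b ≈ c
  atoms-incomparable {b} {c} (0<b , _) (_ , none) b≤c = ≤∧≮⇒≈ b≤c λ b<c → none (b , 0<b , b<c)

  below-bounded : ∀ x → UpperBound (below P a x) x
  below-bounded x = All.map proj₂ (Allₚ.all-filter (below? P a x) elements)

  below-other : ∀ x → All (OtherAtom P a) (below P a x)
  below-other x = All.map proj₁ (Allₚ.all-filter (below? P a x) elements)

  -- The largest element of P′ below x.
  closure : Carrier P → Carrier P
  closure x = proj₁ (join x (below P a x) (below-bounded x))

  closure-isJoin : ∀ x → IsJoin x (below P a x) (closure x)
  closure-isJoin x = proj₂ (join x (below P a x) (below-bounded x))

  closure≤ : ∀ x → closure x ≤ x
  closure≤ x = proj₁ (closure-isJoin x)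

  IsJoin⇒InDeletion : ∀ {x} T {j} → All (OtherAtom P a) T → IsJoin x T j → InDeletion P a j
  IsJoin⇒InDeletion []      _      (_ , _ , least) = inj₁ (≤0̂⇒≈0̂ (least 0̂ (0̂-minimum _) []))
  IsJoin⇒InDeletion (b ∷ T) others isJoin          = inj₂ (b ∷ T , (λ ()) , others , IsJoin⇒∈⋁ isJoin)

  closure∈P′ : ∀ x → InDeletion P a (closure x)
  closure∈P′ x = IsJoin⇒InDeletion (below P a x) (below-other x) (closure-isJoin x)

  -- A nonzero `z` of this kind is a join of other atoms below `x`. These all occur in
  -- `below P a x`, so `closure x` bounds them too.
  closure-greatest : ∀ {x z} → InDeletion P a z → z ≤ x → z ≤ closure x
  closure-greatest {x} (inj₁ z≈0) z≤x = ≤-respˡ-≈ (Eq.sym z≈0) (0̂-minimum _)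
  closure-greatest {x} {z} (inj₂ (T , _ , others , z∈⋁T)) z≤x
    with closure-isJoin x | ∈⋁⇒IsJoin z≤x z∈⋁T
  ... | c≤x , ub , _ | _ , ubᶻ , least =
    least (closure x) c≤x (ub-mono P a x (toBelow P a x others (All.map (λ t≤z → ≤-trans t≤z z≤x) ubᶻ)) ub)

  otherAtom≤closure : ∀ {x b} → OtherAtom P a b → b ≤ x → b ≤ closure x
  otherAtom≤closure {x} {b} other b≤x with closure-isJoin x
  ... | _ , ub , _ with ub-mono P a x (toBelow P a x (other ∷ []) (b≤x ∷ [])) ub
  ...   | b≤c ∷ [] = b≤c

  -- A trivial closure leaves `a` as the only possible atom below `x`. An atom separating `0̂` from
  -- `x` must then be `a`, and `a < x` would yield an atom below `x` but not below `a`.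
  closure≈0̂⇒ : ∀ {x} → closure x ≈ 0̂ → ¬ x ≈ 0̂ → x ≈ a
  closure≈0̂⇒ {x} c≈0 x≉0 = Eq.sym (≤∧≮⇒≈ a≤x a≮x)
    where
    atom≈a : ∀ {b} → Atom P b → b ≤ x → b ≈ a
    atom≈a {b} atom-b b≤x with b ≟ a
    ... | yes b≈a = b≈a
    ... | no  b≉a = contradiction
      (<-≤-trans (proj₁ atom-b) (≤-respʳ-≈ c≈0 (otherAtom≤closure (atom-b , b≉a) b≤x))) <0̂-absurd

    a≤x : a ≤ x
    a≤x = let b , atom-b , b≤x , _ = separatingAtom (≉0̂⇒0̂< x≉0) in ≤-respˡ-≈ (atom≈a atom-b b≤x) b≤x

    a≮x : ¬ a < x
    a≮x a<x = let b , atom-b , b≤x , b≰a = separatingAtom a<x in b≰a (reflexive (atom≈a atom-b b≤x))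

  closure-0̂ : ∀ {x} → x ≈ 0̂ → closure x ≈ 0̂
  closure-0̂ x≈0 = ≤0̂⇒≈0̂ (≤-respʳ-≈ x≈0 (closure≤ _))

  closure-a : ∀ {x} → x ≈ a → closure x ≈ 0̂
  closure-a {x} x≈a with closure-isJoin x
  ... | _ , _ , least = ≤0̂⇒≈0̂ (least 0̂ (0̂-minimum _) (All.map none (All.zip (below-other x , below-bounded x))))
    where
    none : ∀ {b} → OtherAtom P a b × b ≤ x → b ≤ 0̂
    none ((atom-b , b≉a) , b≤x) =
      contradiction (atoms-incomparable atom-b atom-a (≤-respʳ-≈ x≈a b≤x)) b≉a

  -- The Möbius function

  -- The Möbius functions of `P′` and `P″` extended by zero, so that they can be compared on all of
  -- `P`.
  μ′ μ″ : Carrier P → ℤ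
  μ′ x = guard (inDeletion? P a x) (λ q → P′.μ P′.0̂ (x , q))
  μ″ x = guard (a ≤? x) (λ q → P″.μ P″.0̂ (x , q))

  μ′-cong : ∀ {x y} → x ≈ y → μ′ x ≡ μ′ y
  μ′-cong {x} {y} x≈y = guard-cong (inDeletion? P a x) (inDeletion? P a y)
    (InDeletion-resp P a x≈y) (InDeletion-resp P a (Eq.sym x≈y)) (λ _ _ → P′.μ-cong x≈y)

  μ″-cong : ∀ {x y} → x ≈ y → μ″ x ≡ μ″ y
  μ″-cong {x} {y} x≈y = guard-cong (a ≤? x) (a ≤? y)
    (≤-respʳ-≈ x≈y) (≤-respʳ-≈ (Eq.sym x≈y)) (λ _ _ → P″.μ-cong x≈y)

  module _ {B : Pred (Carrier P) 0ℓ} (B? : Decidable B) where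
    -- The predicate `B` serves two purposes: a lower set for the Möbius sums, and a fixed corank
    -- for the coefficients of `χ`.
    ∑-guard-μ′ : ∑[ x ∈ elements ] guard (B? x) (λ _ → μ′ x) ≡
                 ∑[ y ∈ P′.elements ] guard (B? (proj₁ y)) (λ _ → P′.μ P′.0̂ y)
    ∑-guard-μ′ = trans (∑-cong (λ x → guard-swap (B? x) (inDeletion? P a x)) elements)
      (sym (∑-restrict P (inDeletion? P a) (InDeletion-resp P a) 0̂ (inj₁ Eq.refl) (λ x _ → 0̂-minimum x)
             (λ y → guard (B? (proj₁ y)) (λ _ → P′.μ P′.0̂ y)) elements))

    ∑-guard-μ″ : ∑[ x ∈ elements ] guard (B? x) (λ _ → μ″ x) ≡
                 ∑[ y ∈ P″.elements ] guard (B? (proj₁ y)) (λ _ → P″.μ P″.0̂ y)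
    ∑-guard-μ″ = trans (∑-cong (λ x → guard-swap (B? x) (a ≤? x)) elements)
      (sym (∑-restrict P (a ≤?_) ≤-respʳ-≈ a ≤-refl (λ _ a≤x → a≤x)
             (λ y → guard (B? (proj₁ y)) (λ _ → P″.μ P″.0̂ y)) elements))

  -- An element of `P′` lies below `x` exactly when it lies below `closure x`, so this is a full
  -- Möbius sum of `P′` up to `closure x`.
  ∑-μ′ : ∀ x → ∑≤ μ′ x ≡ guard (closure x ≟ 0̂) (λ _ → 1ℤ)
  ∑-μ′ x = trans (∑-guard-μ′ (_≤? x)) (trans
    (∑-cong (λ (y , q) → guard-cong (y ≤? x) (y ≤? closure x)
      (closure-greatest q) (λ y≤c → ≤-trans y≤c (closure≤ x)) (λ _ _ → refl)) P′.elements)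
    (P′.∑-μ (closure x , closure∈P′ x)))

  ∑-μ″ : ∀ x → ∑≤ μ″ x ≡ guard (x ≟ a) (λ _ → 1ℤ)
  ∑-μ″ x = trans (∑-guard-μ″ (_≤? x)) (go (a ≤? x))
    where
    go : Dec (a ≤ x) → ∑[ y ∈ P″.elements ] guard (proj₁ y ≤? x) (λ _ → P″.μ P″.0̂ y) ≡ guard (x ≟ a) (λ _ → 1ℤ)
    go (yes a≤x) = P″.∑-μ (x , a≤x)
    go (no a≰x)  = trans
      (∑-zero (All.universal (λ (y , a≤y) → guard-no (y ≤? x) (a≰x ∘ ≤-trans a≤y)) P″.elements))
      (sym (guard-no (x ≟ a) (a≰x ∘ reflexive ∘ Eq.sym)))

  μ≡μ′-μ″ : ∀ x → μ 0̂ x ≡ μ′ x ℤ.- μ″ x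
  μ≡μ′-μ″ = μ-unique (λ x → μ′ x ℤ.- μ″ x) (λ x≈y → cong₂ ℤ._-_ (μ′-cong x≈y) (μ″-cong x≈y)) λ x → begin
    ∑≤ (λ y → μ′ y ℤ.- μ″ y) x
      ≡⟨ ∑-cong (λ y → guard-- (y ≤? x) (μ′ y) (μ″ y)) elements ⟩
    ∑[ y ∈ elements ] (guard (y ≤? x) (λ _ → μ′ y) ℤ.- guard (y ≤? x) (λ _ → μ″ y))
      ≡⟨ ∑-- elements ⟩
    ∑≤ μ′ x ℤ.- ∑≤ μ″ x
      ≡⟨ cong₂ ℤ._-_ (∑-μ′ x) (∑-μ″ x) ⟩
    guard (closure x ≟ 0̂) (λ _ → 1ℤ) ℤ.- guard (x ≟ a) (λ _ → 1ℤ)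
      -- The closure is `0̂` exactly at `0̂` and at `a`; the second indicator removes `a`.
      ≡⟨ indicators x (closure x ≟ 0̂) (x ≟ a) (x ≟ 0̂) ⟩
    δ x ∎
    where
    open ≡-Reasoning
    indicators : ∀ x (d : Dec (closure x ≈ 0̂)) (e : Dec (x ≈ a)) (e′ : Dec (x ≈ 0̂)) →
                 guard d (λ _ → 1ℤ) ℤ.- guard e (λ _ → 1ℤ) ≡ guard e′ (λ _ → 1ℤ)
    indicators x _         (yes x≈a) (yes x≈0) =
      contradiction (Eq.trans (Eq.sym x≈0) x≈a) (proj₂ (proj₁ atom-a))
    indicators x (yes _)   (yes _)   (no _)    = refl
    indicators x (yes _)   (no _)    (yes _)   = refl
    indicators x (yes c≈0) (no x≉a)  (no x≉0)  = contradiction (closure≈0̂⇒ c≈0 x≉0) x≉a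
    indicators x (no c≉0)  (yes x≈a) (no _)    = contradiction (closure-a x≈a) c≉0
    indicators x (no c≉0)  (no _)    (yes x≈0) = contradiction (closure-0̂ x≈0) c≉0
    indicators x (no _)    (no _)    (no _)    = refl

  -- Ranks

  rk′≤rk : ∀ y → P′.rk y ℕ.≤ rk (proj₁ y)
  rk′≤rk = All.wfRec P′.<-wellFounded 0ℓ _ go
    where
    go : ∀ y → (∀ {z} → z P′.< y → P′.rk z ℕ.≤ rk (proj₁ z)) → P′.rk y ℕ.≤ rk (proj₁ y)
    go y rec = [ (λ e → ℕₚ.≤-trans (ℕₚ.≤-reflexive e) z≤n)
               , (λ (z , z<y , e) → ℕₚ.≤-trans (ℕₚ.≤-reflexive e) (ℕₚ.≤-trans (s≤s (rec z<y)) (rk-mono-< z<y)))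
               ]′ (P′.rk-attained y)

  coveredInP′ : ∀ {x} → InDeletion P a x → x ≈ 0̂ ⊎ ∃ λ i → InDeletion P a i × i ⋖ x
  coveredInP′ (inj₁ x≈0) = inj₁ x≈0
  coveredInP′ (inj₂ (T , _ , others , x∈⋁T))
    with coveredByJoin (OtherAtom P a) proj₁ T others (proj₁ x∈⋁T) (∈⋁⇒IsJoin ≤-refl x∈⋁T)
  ... | inj₁ x≈0                             = inj₁ x≈0
  ... | inj₂ (S , others′ , i , isJoin , i⋖x) = inj₂ (i , IsJoin⇒InDeletion S others′ isJoin , i⋖x)

  -- Every nonzero element of `P′` covers, in `P`, another element of `P′`. Descending along such
  -- covers lowers the rank in `P` by exactly 1 while staying in `P′`.
  rk≤rk′ : ∀ y → rk (proj₁ y) ℕ.≤ P′.rk y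
  rk≤rk′ = All.wfRec P′.<-wellFounded 0ℓ _ go
    where
    go : ∀ y → (∀ {z} → z P′.< y → rk (proj₁ z) ℕ.≤ P′.rk z) → rk (proj₁ y) ℕ.≤ P′.rk y
    go y rec = [ (λ x≈0 → ℕₚ.≤-trans (ℕₚ.≤-reflexive (rk-0̂ x≈0)) z≤n)
               , (λ (i , q , i⋖x) → ℕₚ.≤-trans (ℕₚ.≤-reflexive (⋖-rk ranked i⋖x))
                   (ℕₚ.≤-trans (s≤s (rec {i , q} (proj₁ i⋖x))) (P′.rk-mono-< {i , q} {y} (proj₁ i⋖x))))
               ]′ (coveredInP′ (proj₂ y))

  rk′≡rk : ∀ y → P′.rk y ≡ rk (proj₁ y)
  rk′≡rk y = ℕₚ.≤-antisym (rk′≤rk y) (rk≤rk′ y)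

  -- Since `a` is an atom, putting `0̂` in front of a maximal chain of `P″` gives a maximal chain of
  -- `P`, one step longer.
  suc-rk″≡rk : ∀ y → suc (P″.rk y) ≡ rk (proj₁ y)
  suc-rk″≡rk y = maximalChain-rk ranked (prepend-0̂ (P″.maximalChain y))
    where
    prepend-0̂ : ∀ {y n} → P″.MaximalChain y n → MaximalChain (proj₁ y) (suc n)
    prepend-0̂ (P″.start x≈a) = extend (start Eq.refl) (Atom-resp P (Eq.sym x≈a) atom-a)
    prepend-0̂ (P″.extend {x} {y} c (x<y , none)) = extend (prepend-0̂ c)
      (x<y , λ (z , p , q) → none ((z , ≤-trans (proj₂ x) (proj₁ p)) , p , q))

  rank′≤rank : P′.rank ℕ.≤ rank
  rank′≤rank = let y , e = P′.rank-attained in begin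
    P′.rank      ≡⟨ e ⟩
    P′.rk y      ≡⟨ rk′≡rk y ⟩
    rk (proj₁ y) ≤⟨ rk≤rank (proj₁ y) ⟩
    rank         ∎
    where open ℕₚ.≤-Reasoning

  -- If `c < x`, any atom below `x` but not below `c` is `a`. Its join `w` with `c` covers `c` and
  -- lies above every atom below `x`, so no atom separates `w` from `x`.
  otherAtoms≤⇒⋖ : ∀ {c x} → c ≤ x → (∀ {b} → OtherAtom P a b → b ≤ x → b ≤ c) → x ≈ c ⊎ c ⋖ x
  otherAtoms≤⇒⋖ {c} {x} c≤x others≤c with c <? x
  ... | no  c≮x = inj₁ (Eq.sym (≤∧≮⇒≈ c≤x c≮x))
  ... | yes c<x with separatingAtom c<x
  ...   | b , atom-b , b≤x , b≰c with binaryJoin c≤x b≤x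
  ...     | w , (w≤x , c≤w , b≤w , _) , cover = inj₂ (⋖-respʳ-≈ w≈x (cover atom-b b≰c))
    where
    b≈a : b ≈ a
    b≈a with b ≟ a
    ... | yes e   = e
    ... | no  b≉a = contradiction (others≤c (atom-b , b≉a) b≤x) b≰c

    atoms≤w : ∀ {d} → Atom P d → d ≤ x → d ≤ w
    atoms≤w {d} atom-d d≤x with d ≟ a
    ... | yes d≈a = ≤-respˡ-≈ (Eq.trans b≈a (Eq.sym d≈a)) b≤w
    ... | no  d≉a = ≤-trans (others≤c (atom-d , d≉a) d≤x) c≤w

    w≈x : w ≈ x
    w≈x = ≤∧≮⇒≈ w≤x λ w<x → let _ , atom-d , d≤x , d≰w = separatingAtom w<x in d≰w (atoms≤w atom-d d≤x)

  rank≤suc-rank′ : rank ℕ.≤ suc P′.rank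
  rank≤suc-rank′ = let x , e = rank-attained in begin
    rank                                    ≡⟨ e ⟩
    rk x                                    ≤⟨ bound (otherAtoms≤⇒⋖ (closure≤ x) otherAtom≤closure) ⟩
    suc (rk (closure x))                    ≡⟨ cong suc (rk′≡rk (closure x , closure∈P′ x)) ⟨
    suc (P′.rk (closure x , closure∈P′ x))  ≤⟨ s≤s (P′.rk≤rank _) ⟩
    suc P′.rank                             ∎
    where
    open ℕₚ.≤-Reasoning
    bound : ∀ {c x} → x ≈ c ⊎ c ⋖ x → rk x ℕ.≤ suc (rk c)
    bound (inj₁ x≈c) = ℕₚ.m≤n⇒m≤1+n (ℕₚ.≤-reflexive (rk-cong x≈c))
    bound (inj₂ c⋖x) = ℕₚ.≤-reflexive (⋖-rk ranked c⋖x)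

  separator⇒rank : Separator P a → rank ≡ suc P′.rank
  separator⇒rank sep = trans (sym (ℕₚ.m∸n+n≡m rank′≤rank)) (cong (ℕ._+ P′.rank) sep)

  nonseparator⇒rank : ¬ Separator P a → rank ≡ P′.rank
  nonseparator⇒rank ¬sep =
    [ (λ rank< → ℕₚ.≤-antisym (ℕ.s≤s⁻¹ rank<) rank′≤rank)
    , (λ rank≡ → contradiction (trans (cong (_∸ P′.rank) rank≡) (ℕₚ.m+n∸n≡m 1 P′.rank)) ¬sep)
    ]′ (ℕₚ.m≤n⇒m<n∨m≡n rank≤suc-rank′)

  -- The characteristic polynomial

  module _ (rank≡ : rank ≡ suc P″.rank) where
    -- The assumption on `rank` makes coranks in `P″` equal to those in `P`. The sum over `P′` keeps
    -- the rank of `P`, because its relation to `P′.rank` depends on whether `a` is a separator.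
    coeff-χ-split : ∀ k → coeff χ k ≡
      ∑[ y ∈ P′.elements ] guard (rank ∸ P′.rk y ℕₚ.≟ k) (λ _ → P′.μ P′.0̂ y) ℤ.- coeff P″.χ k
    coeff-χ-split k = begin
      coeff χ k
        ≡⟨ coeff-χ k ⟩
      ∑[ x ∈ elements ] guard (B? x) (λ _ → μ 0̂ x)
        ≡⟨ ∑-cong (λ x → trans (cong (λ c → guard (B? x) (λ _ → c)) (μ≡μ′-μ″ x)) (guard-- (B? x) (μ′ x) (μ″ x))) elements ⟩
      ∑[ x ∈ elements ] (guard (B? x) (λ _ → μ′ x) ℤ.- guard (B? x) (λ _ → μ″ x))
        ≡⟨ ∑-- elements ⟩
      ∑[ x ∈ elements ] guard (B? x) (λ _ → μ′ x) ℤ.- ∑[ x ∈ elements ] guard (B? x) (λ _ → μ″ x)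
        ≡⟨ cong₂ ℤ._-_ (∑-guard-μ′ B?) (∑-guard-μ″ B?) ⟩
      ∑[ y ∈ P′.elements ] guard (B? (proj₁ y)) (λ _ → P′.μ P′.0̂ y) ℤ.-
        ∑[ y ∈ P″.elements ] guard (B? (proj₁ y)) (λ _ → P″.μ P″.0̂ y)
        ≡⟨ cong₂ ℤ._-_
             (∑-cong (λ y → cong (λ r → guard (rank ∸ r ℕₚ.≟ k) (λ _ → P′.μ P′.0̂ y)) (sym (rk′≡rk y))) P′.elements)
             (∑-cong (λ y → cong (λ r → guard (r ℕₚ.≟ k) (λ _ → P″.μ P″.0̂ y)) (corank y)) P″.elements) ⟩
      ∑[ y ∈ P′.elements ] guard (rank ∸ P′.rk y ℕₚ.≟ k) (λ _ → P′.μ P′.0̂ y) ℤ.-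
        ∑[ y ∈ P″.elements ] guard (P″.rank ∸ P″.rk y ℕₚ.≟ k) (λ _ → P″.μ P″.0̂ y)
        ≡⟨ cong (λ s → ∑[ y ∈ P′.elements ] guard (rank ∸ P′.rk y ℕₚ.≟ k) (λ _ → P′.μ P′.0̂ y) ℤ.- s) (P″.coeff-χ k) ⟨
      ∑[ y ∈ P′.elements ] guard (rank ∸ P′.rk y ℕₚ.≟ k) (λ _ → P′.μ P′.0̂ y) ℤ.- coeff P″.χ k
        ∎
      where
      open ≡-Reasoning
      B? : (x : Carrier P) → Dec (rank ∸ rk x ≡ k)
      B? x = rank ∸ rk x ℕₚ.≟ k

      corank : ∀ y → rank ∸ rk (proj₁ y) ≡ P″.rank ∸ P″.rk y
      corank y = cong₂ _∸_ rank≡ (sym (suc-rk″≡rk y))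

    nonseparator-χ : rank ≡ P′.rank → ∀ k → coeff χ k ≡ coeff P′.χ k ℤ.- coeff P″.χ k
    nonseparator-χ rank≡rank′ k = trans (coeff-χ-split k) (cong (ℤ._- coeff P″.χ k)
      (trans (cong (λ r → ∑[ y ∈ P′.elements ] guard (r ∸ P′.rk y ℕₚ.≟ k) (λ _ → P′.μ P′.0̂ y)) rank≡rank′)
             (sym (P′.coeff-χ k))))

    -- Each corank exceeds the one computed in `P′` by 1, which multiplies `P′.χ` by t and leaves no
    -- constant term.
    separator-χ : rank ≡ suc P′.rank → ∀ k → coeff χ k ≡ coeff (P′.χ ·t) k ℤ.- coeff P″.χ k
    separator-χ rank≡suc k = trans (coeff-χ-split k) (cong (ℤ._- coeff P″.χ k) (shift k))
      where
      corank : ∀ y → rank ∸ P′.rk y ≡ suc (P′.rank ∸ P′.rk y)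
      corank y = trans (cong (_∸ P′.rk y) rank≡suc) (ℕₚ.+-∸-assoc 1 (P′.rk≤rank y))

      shift : ∀ k → ∑[ y ∈ P′.elements ] guard (rank ∸ P′.rk y ℕₚ.≟ k) (λ _ → P′.μ P′.0̂ y) ≡ coeff (P′.χ ·t) k
      shift zero    = ∑-zero (All.universal (λ y → guard-no (rank ∸ P′.rk y ℕₚ.≟ 0)
        (λ e → ℕₚ.1+n≢0 (trans (sym (corank y)) e))) P′.elements)
      shift (suc k) = trans
        (∑-cong (λ y → guard-cong (rank ∸ P′.rk y ℕₚ.≟ suc k) (P′.rank ∸ P′.rk y ℕₚ.≟ k)
          (λ e → ℕₚ.suc-injective (trans (sym (corank y)) e)) (λ e → trans (corank y) (cong suc e))
          (λ _ _ → refl)) P′.elements)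
        (sym (P′.coeff-χ k))

-- Inductiveness and exponents of a poset from its deletion and restriction.

theorem3p13 : (P : FinitePoset) → Ranked P → LocallyGeometric P →
    (a : Carrier P) → Atom P a →
    (¬ Separator P a → (ds : List ℕ) (d : ℕ) →
    Inductive (restriction P a) → Exp (restriction P a) ds →
    Inductive (deletion P a) → Exp (deletion P a) (ds ++ [ d ]) →
    Inductive P × Exp P (ds ++ [ suc d ]))
    ×
    (Separator P a → (ds : List ℕ) →
    Inductive (restriction P a) → Exp (restriction P a) ds →
    Inductive (deletion P a) → Exp (deletion P a) ds →
    Inductive P × Exp P (1 ∷ ds))
theorem3p13 P ranked geometric a atom-a = nonseparator , separator
  where
  open DeletionRestriction P ranked geometric a atom-a
  open FinitePoset P using (rank; χ)

  χ-roots : ∀ Q ds → Exp Q ds → FinitePoset.rank Q ≡ length ds × FinitePoset.χ Q ≈ₚ ∏t- (map +_ ds)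
  χ-roots Q ds (_ , roots) =
    let rank≡ , χ≈ = monic-HasRoots (map +_ ds) (PosetProperties.χ-monic Q) roots
    in trans rank≡ (length-map +_ ds) , χ≈

  nonseparator : ¬ Separator P a → ∀ ds d → Inductive P″ → Exp P″ ds → Inductive P′ → Exp P′ (ds ++ [ d ]) →
                 Inductive P × Exp P (ds ++ [ suc d ])
  nonseparator ¬sep ds d ind″ exp″ ind′ exp′ =
    -- The quotient of the two characteristic polynomials is the factor of the extra exponent `d`.
    step ranked geometric a atom-a ind′ ind″ (t- (+ d) , divides) ,
    positive , ≈∏t-⇒HasRoots {χ} (map +_ (ds ++ [ suc d ])) χ≈
    where
    open ≡-Reasoning
    Q : Poly
    Q = ∏t- (map +_ ds)

    rank≡rank′ : rank ≡ P′.rank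
    rank≡rank′ = nonseparator⇒rank ¬sep

    χ″≈ : P″.χ ≈ₚ Q
    χ″≈ = proj₂ (χ-roots P″ ds exp″)

    χ′≈ : P′.χ ≈ₚ (t- (+ d)) *ₚ Q
    χ′≈ k = trans (proj₂ (χ-roots P′ (ds ++ [ d ]) exp′) k)
      (trans (cong (λ rs → coeff (∏t- rs) k) (map-++ +_ ds [ d ])) (∏t--∷ʳ (map +_ ds) (+ d) k))

    divides : P′.χ ≈ₚ (t- (+ d)) *ₚ P″.χ
    divides k = trans (χ′≈ k) (sym (t-*ₚ-congˡ (+ d) {P″.χ} {Q} χ″≈ k))

    -- Counting exponents gives the ranks: `P′` has exactly one exponent more than `P″`.
    rank≡suc-rank″ : rank ≡ suc P″.rank
    rank≡suc-rank″ = begin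
      rank                ≡⟨ rank≡rank′ ⟩
      P′.rank             ≡⟨ proj₁ (χ-roots P′ (ds ++ [ d ]) exp′) ⟩
      length (ds ++ [ d ]) ≡⟨ length-++ ds ⟩
      length ds ℕ.+ 1     ≡⟨ ℕₚ.+-comm (length ds) 1 ⟩
      suc (length ds)     ≡⟨ cong suc (proj₁ (χ-roots P″ ds exp″)) ⟨
      suc P″.rank         ∎

    positive : All (0 ℕ.<_) (ds ++ [ suc d ])
    positive = Allₚ.++⁺ (proj₁ exp″) (s≤s z≤n ∷ [])

    χ≈ : χ ≈ₚ ∏t- (map +_ (ds ++ [ suc d ]))
    χ≈ k = begin
      coeff χ k
        ≡⟨ nonseparator-χ rank≡suc-rank″ rank≡rank′ k ⟩
      coeff P′.χ k ℤ.- coeff P″.χ k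
        ≡⟨ cong₂ ℤ._-_ (trans (χ′≈ k) (coeff-t- (+ d) Q k)) (χ″≈ k) ⟩
      (ℤ.- (+ d)) ℤ.* coeff Q k ℤ.+ coeff (Q ·t) k ℤ.- coeff Q k
        -- Subtracting `Q` from (t - d)`Q` raises the root `d` by 1.
        ≡⟨ solve 3 (λ d q q′ → (:- d) :* q :+ q′ :- q := (:- (con 1ℤ :+ d)) :* q :+ q′)
             refl (+ d) (coeff Q k) (coeff (Q ·t) k) ⟩
      (ℤ.- (+ suc d)) ℤ.* coeff Q k ℤ.+ coeff (Q ·t) k
        ≡⟨ coeff-t- (+ suc d) Q k ⟨
      coeff ((t- (+ suc d)) *ₚ Q) k
        ≡⟨ ∏t--∷ʳ (map +_ ds) (+ suc d) k ⟨
      coeff (∏t- (map +_ ds ++ [ + suc d ])) k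
        ≡⟨ cong (λ rs → coeff (∏t- rs) k) (map-++ +_ ds [ suc d ]) ⟨
      coeff (∏t- (map +_ (ds ++ [ suc d ]))) k
        ∎
      where open +-*-Solver

  separator : Separator P a → ∀ ds → Inductive P″ → Exp P″ ds → Inductive P′ → Exp P′ ds →
              Inductive P × Exp P (1 ∷ ds)
  separator sep ds ind″ exp″ ind′ exp′ =
    -- The two characteristic polynomials coincide, so the quotient is 1.
    step ranked geometric a atom-a ind′ ind″ ([ 1ℤ ] , divides) ,
    s≤s z≤n ∷ proj₁ exp″ , ≈∏t-⇒HasRoots {χ} (map +_ (1 ∷ ds)) χ≈
    where
    open ≡-Reasoning
    Q : Poly
    Q = ∏t- (map +_ ds)

    χ″≈ : P″.χ ≈ₚ Q
    χ″≈ = proj₂ (χ-roots P″ ds exp″)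

    χ′≈ : P′.χ ≈ₚ Q
    χ′≈ = proj₂ (χ-roots P′ ds exp′)

    divides : P′.χ ≈ₚ [ 1ℤ ] *ₚ P″.χ
    divides k = trans (χ′≈ k) (trans (sym (χ″≈ k)) (sym (*ₚ-identityˡ P″.χ k)))

    rank≡suc-rank″ : rank ≡ suc P″.rank
    rank≡suc-rank″ = begin
      rank            ≡⟨ separator⇒rank sep ⟩
      suc P′.rank     ≡⟨ cong suc (proj₁ (χ-roots P′ ds exp′)) ⟩
      suc (length ds) ≡⟨ cong suc (proj₁ (χ-roots P″ ds exp″)) ⟨
      suc P″.rank     ∎

    χ≈ : χ ≈ₚ (t- 1ℤ) *ₚ Q
    χ≈ k = begin
      coeff χ k
        ≡⟨ separator-χ rank≡suc-rank″ (separator⇒rank sep) k ⟩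
      coeff (P′.χ ·t) k ℤ.- coeff P″.χ k
        ≡⟨ cong₂ ℤ._-_ (·t-cong {P′.χ} {Q} χ′≈ k) (χ″≈ k) ⟩
      coeff (Q ·t) k ℤ.- coeff Q k
        -- The shift contributes t`Q`, and subtracting `Q` creates the new root 1.
        ≡⟨ solve 2 (λ q q′ → q′ :- q := (:- con 1ℤ) :* q :+ q′) refl (coeff Q k) (coeff (Q ·t) k) ⟩
      (ℤ.- 1ℤ) ℤ.* coeff Q k ℤ.+ coeff (Q ·t) k
        ≡⟨ coeff-t- 1ℤ Q k ⟨
      coeff ((t- 1ℤ) *ₚ Q) k
        ∎
      where open +-*-Solver
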